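{- For every non-trivial weak tree $T$, $DD_{\mathrm{m}}(T) = S(T) = e_{\mathrm{m}}^\infty(T)$.
   Context: Graphs are finite, simple and undirected; a graph is non-trivial if it has at least two vertices. A weak graph is one in which no vertex is adjacent to two or more vertices of degree one. Swap number: a dominating set $D$ of a graph $G$ is a swap set if there is a dominating set $D'$ of $G$ with $D\cap D'=\emptyset$, $|D|=|D'|$, such that $G$ contains a perfect matching between $D$ and $D'$ (a bijection $f:D\to D'$ with $x f(x)\in E(G)$ for all $x\in D$). $DD_{\mathrm{m}}(G)$ is the minimum cardinality of a swap set of $G$, and $DD_{\mathrm{m}}(G)=\infty$ if none exists. Simple star partitioning: a star is $K_{1,n}$, $n\ge 1$; a single vertex $K_1$ is also allowed as a (degenerate) star part of order 1. A leaf is a vertex of degree one. A simple star partitioning $P$ of a non-trivial tree $T$ is a partition of $V(T)$ such that (i) each part induces a star (possibly $K_1$); (ii) each vertex of $T$ adjacent to exactly one leaf forms a $K_2$ part of $P$ together with this leaf; (iii) any $K_1$ part is adjacent to at least two parts that are not $K_1$'s (two parts are adjacent if some edge of $T$ joins them). A part of order $k$ has weight $k-1$; the weight of $P$ is the sum of the weights of its parts. $S(T)$ is the minimum weight of a simple star partitioning of $T$. Eviction number (m-eternal eviction model): guards occupy the vertices of a dominating set $D$ (one guard per vertex). When a vertex $v\in D$ is attacked, each guard moves to a vertex in the closed neighborhood of its current vertex so that the guards then occupy a dominating set $D'$ (of the same size) with $v\notin D'$. $e_{\mathrm{m}}^\infty(G)$ is the minimum number of guards that can defend against every infinite sequence of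 attacks; i.e. the least $k$ for which there is a non-empty family $\mathcal{F}$ of dominating sets of size $k$ such that for all $D\in\mathcal{F}$ and $v\in D$ there are $D'\in\mathcal{F}$ with $v\notin D'$ and a bijection $f:D\to D'$ with $f(x)\in N[x]$ for all $x\in D$. -}

module Defs where

open import Level using (Level; 0ℓ) renaming (suc to lsuc)
open import Algebra.Properties.CommutativeMonoid.Sum using (sum)
open import Data.Fin.Base using (Fin; zero; suc; inject₁; fromℕ)
open import Data.Fin.Subset using (Subset; _∈_; _∉_; _∩_; _∪_; ⁅_⁆; ∣_∣; Nonempty; Empty)
open import Data.Nat.Base using (ℕ; suc; _≤_; _∸_)
open import Data.Nat.Properties using (+-0-commutativeMonoid)
open import Data.Product.Base using (Σ; ∃; ∃₂; _×_; proj₁)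
open import Data.Sum.Base using (_⊎_)
open import Data.Vec.Base using (tabulate)
open import Function.Bundles using (_⤖_; Bijection)
open import Function.Definitions using (Injective)
open import Relation.Binary.Construct.Closure.ReflexiveTransitive using (Star)
open import Relation.Binary.Core using (Rel)
open import Relation.Binary.Definitions using (Decidable; Symmetric)
open import Relation.Binary.PropositionalEquality.Core using (_≡_; _≢_)
open import Relation.Nullary.Construct.Add.Supremum using (_⁺; [_]; ⊤⁺)
open import Relation.Nullary.Decidable.Core using (does)
open import Relation.Nullary.Negation.Core using (¬_)
open import Relation.Unary using (Pred)

IsMinimum : ∀ {ℓ : Level} → Pred ℕ ℓ → Pred ℕ ℓ
IsMinimum P k = P k × (∀ j → P j → k ≤ j)

-- The minimum of the empty set is ∞, written ⊤⁺.
IsMinimum⁺ : ∀ {ℓ : Level} → Pred ℕ ℓ → Pred (ℕ ⁺) ℓ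
IsMinimum⁺ P [ k ] = IsMinimum P k
IsMinimum⁺ P ⊤⁺    = ∀ j → ¬ P j

record Graph (n : ℕ) : Set₁ where
  field
    Adj    : Rel (Fin n) 0ℓ
    adj?   : Decidable Adj
    sym    : Symmetric Adj
    irrefl : ∀ v → ¬ Adj v v

module _ {n : ℕ} (G : Graph n) where
  open Graph G

  neighbourhood : Fin n → Subset n
  neighbourhood v = tabulate (λ u → does (adj? v u))

  degree : Fin n → ℕ
  degree v = ∣ neighbourhood v ∣

  IsLeaf : Pred (Fin n) 0ℓ
  IsLeaf v = degree v ≡ 1

  IsWeak : Set
  IsWeak = ¬ (∃ λ v → ∃₂ λ u w → u ≢ w × Adj v u × Adj v w × IsLeaf u × IsLeaf w)

  -- Since Star is the reflexive-transitive closure, this is the existence of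
  -- a walk between any two vertices.
  IsConnected : Set
  IsConnected = ∀ u v → Star Adj u v

  -- A cycle c₀ c₁ … cₘ on suc m ≥ 3 distinct vertices.
  record Cycle : Set where
    field
      m         : ℕ
      2≤m       : 2 ≤ m
      c         : Fin (suc m) → Fin n
      injective : Injective _≡_ _≡_ c
      step      : ∀ i → Adj (c (inject₁ i)) (c (suc i))
      close     : Adj (c (fromℕ m)) (c zero)

  record IsTree : Set where
    field
      nonempty  : 1 ≤ n
      connected : IsConnected
      acyclic   : ¬ Cycle

  IsDominating : Pred (Subset n) 0ℓ
  IsDominating D = ∀ v → v ∈ D ⊎ (∃ λ u → u ∈ D × Adj u v)

  -- Membership in a Subset is proof-irrelevant, so this is the subset as a type.
  ⟦_⟧ : Subset n → Set
  ⟦ D ⟧ = Σ (Fin n) (_∈ D)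

  PerfectMatching : Rel (Subset n) 0ℓ
  PerfectMatching D D′ =
    Σ (⟦ D ⟧ ⤖ ⟦ D′ ⟧) λ f → ∀ x → Adj (proj₁ x) (proj₁ (Bijection.to f x))

  IsSwapSet : Pred (Subset n) 0ℓ
  IsSwapSet D = IsDominating D ×
    (∃ λ D′ → IsDominating D′ × Empty (D ∩ D′) × ∣ D ∣ ≡ ∣ D′ ∣ × PerfectMatching D D′)

  -- DDₘ(G) = k
  IsSwapNumber : Pred (ℕ ⁺) 0ℓ
  IsSwapNumber = IsMinimum⁺ (λ k → ∃ λ D → IsSwapSet D × ∣ D ∣ ≡ k)

  -- A star K₁,ₘ with centre c; A = ⁅ c ⁆ is the degenerate star K₁.
  InducesStar : Pred (Subset n) 0ℓ
  InducesStar A = ∃ λ c → c ∈ A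
    × (∀ {x} → x ∈ A → x ≢ c → Adj c x)
    × (∀ {x y} → x ∈ A → y ∈ A → x ≢ c → y ≢ c → ¬ Adj x y)

  AdjacentParts : Rel (Subset n) 0ℓ
  AdjacentParts A B = ∃₂ λ u v → u ∈ A × v ∈ B × Adj u v

  record SimpleStarPartitioning : Set where
    field
      size     : ℕ
      part     : Fin size → Subset n
      nonempty : ∀ i → Nonempty (part i)
      disjoint : ∀ {i j} → i ≢ j → Empty (part i ∩ part j)
      covers   : ∀ v → ∃ λ i → v ∈ part i
      star     : ∀ i → InducesStar (part i)
      leafPart : ∀ {v ℓ} → Adj v ℓ → IsLeaf ℓ → (∀ {w} → Adj v w → IsLeaf w → w ≡ ℓ) →
                 ∃ λ i → part i ≡ ⁅ v ⁆ ∪ ⁅ ℓ ⁆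
      single   : ∀ i → ∣ part i ∣ ≡ 1 → ∃₂ λ j k → j ≢ k
                 × AdjacentParts (part i) (part j) × ∣ part j ∣ ≢ 1
                 × AdjacentParts (part i) (part k) × ∣ part k ∣ ≢ 1

    weight : ℕ
    weight = sum +-0-commutativeMonoid (λ i → ∣ part i ∣ ∸ 1)

  -- S(G) = k
  IsStarNumber : Pred ℕ 0ℓ
  IsStarNumber = IsMinimum (λ k → ∃ λ P → SimpleStarPartitioning.weight P ≡ k)

  GuardMove : Rel (Subset n) 0ℓ
  GuardMove D D′ = Σ (⟦ D ⟧ ⤖ ⟦ D′ ⟧) λ f → ∀ x →
    let y = proj₁ (Bijection.to f x) in y ≡ proj₁ x ⊎ Adj (proj₁ x) y

  record EvictionFamily (k : ℕ) : Set₁ where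
    field
      Member     : Pred (Subset n) 0ℓ
      inhabited  : ∃ Member
      dominating : ∀ {D} → Member D → IsDominating D
      guards     : ∀ {D} → Member D → ∣ D ∣ ≡ k
      respond    : ∀ {D} → Member D → ∀ {v} → v ∈ D →
                   ∃ λ D′ → Member D′ × v ∉ D′ × GuardMove D D′

  -- eₘ^∞(G) = k
  IsEvictionNumber : Pred ℕ (lsuc 0ℓ)
  IsEvictionNumber = IsMinimum EvictionFamily

{-# OPTIONS --safe #-}
-- Root the tree at the neighbour of a leaf and give every vertex a type, from the
-- leaves upwards: it has type Z if some child has type L; otherwise L if some
-- child has type X₁ or no child has type Z; otherwise X₁ or X₂, according to
-- whether it has exactly one or at least two children of type Z. All three
-- parameters equal the number of vertices of type L.
--
-- Upper bounds: match every Z vertex with an L child, a leaf if there is one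
-- (weakness allows at most one), and every other L vertex with an X child. An
-- unmatched vertex has two matched neighbours: two Z children for X₂, the Z child
-- and the parent for X₁. So the matching edges and the remaining singletons form
-- a simple star partitioning. Colouring the tree from the root downwards, the ends
-- of every matching edge and the two neighbours chosen for every unmatched vertex
-- can be given different colours; then the two colour classes of matched vertices
-- are a swap set and its partner, and they alternate as an eviction family.
--
-- Lower bounds: by induction from the leaves, each subtree contains enough star
-- edges, or enough guards in every configuration of an eviction family, to pay
-- for its L vertices. For guards, the subtree of an L vertex v may be one guard
-- short while the parent p of v is occupied; but when p is attacked, no guard
-- enters the subtree of p, so the subtree of p is never short.
module Submission where

open import Data.Bool.Base using (Bool; true; false; not; if_then_else_)
open import Data.Bool.Properties using (not-involutive; not-¬) renaming (_≟_ to _≟ᵇ_)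
open import Data.Fin.Base using (Fin; zero; suc; inject₁; fromℕ)
open import Data.Fin.Properties using (_≟_; any?; suc-injective)
open import Data.Fin.Subset using (Subset; _∈_; _∉_; _∩_; _∪_; ⁅_⁆; ∣_∣; Empty; inside; outside)
open import Data.Fin.Subset.Properties using (_∈?_; x∈⁅x⁆; x∈⁅y⁆⇒x≡y; ∣⁅x⁆∣≡1; x∈p∩q⁺; x∈p∩q⁻; x∈p∪q⁺; x∈p∪q⁻; x∈p⇒∣p-x∣<∣p∣; x∈p∧x≢y⇒x∈p-y; ⊆-antisym; ∪-comm)
open import Data.Nat.Base using (ℕ; zero; suc; _+_; _*_; _∸_; _≤_; _<_; z≤n; s≤s)
open import Data.Nat.Properties renaming (_≟_ to _≟ⁿ_) hiding (suc-injective)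
open import Algebra.Properties.Semiring.Sum +-*-semiring using (sum; sum-cong-≗; ∑-distrib-+; ∑-comm; *-distribˡ-sum; *-distribʳ-sum)
open import Data.Product.Base using (Σ; ∃; ∃₂; _×_; _,_; proj₁; proj₂)
open import Data.Sum.Base using (_⊎_; inj₁; inj₂; [_,_]′)
open import Data.Vec.Base using ([]; _∷_; tabulate)
open import Data.Vec.Properties.WithK using ([]=-irrelevant)
open import Data.Vec.Properties using (lookup∘tabulate; lookup⇒[]=; []=⇒lookup)
open import Function.Base using (_∘_; id)
open import Function.Bundles using (Bijection; mk⤖)
open import Function.Properties.Bijection using (sym-≡)
open import Level using (Level)
open import Relation.Binary.Construct.Closure.ReflexiveTransitive using (Star; ε; _◅_; _◅◅_; reverse)
open import Relation.Binary.PropositionalEquality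
open import Relation.Nullary.Construct.Add.Supremum using ([_])
open import Relation.Nullary.Decidable using (Dec; yes; no; does; ¬?; _×-dec_; _⊎-dec_; dec-true; dec-false; decidable-stable; map′)
open import Relation.Nullary.Negation using (¬_; contradiction)
open import Defs

private
  variable
    a b : Level
    A B : Set a
    m n : ℕ

-- Sums over Fin and indicator functions

sum-mono-≤ : {f g : Fin n → ℕ} → (∀ i → f i ≤ g i) → sum f ≤ sum g
sum-mono-≤ {zero}  f≤g = z≤n
sum-mono-≤ {suc n} f≤g = +-mono-≤ (f≤g zero) (sum-mono-≤ (f≤g ∘ suc))

sum-mono-< : {f g : Fin n → ℕ} → (∀ i → f i ≤ g i) → ∀ j → f j < g j → sum f < sum g
sum-mono-< f≤g zero    fj<gj = +-mono-<-≤ fj<gj (sum-mono-≤ (f≤g ∘ suc))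
sum-mono-< f≤g (suc j) fj<gj = +-mono-≤-< (f≤g zero) (sum-mono-< (f≤g ∘ suc) j fj<gj)

sum-zero : {f : Fin n → ℕ} → (∀ i → f i ≡ 0) → sum f ≡ 0
sum-zero {zero}  f≡0 = refl
sum-zero {suc n} f≡0 = cong₂ _+_ (f≡0 zero) (sum-zero (f≡0 ∘ suc))

sum-single : {f : Fin n → ℕ} → ∀ j → (∀ i → i ≢ j → f i ≡ 0) → sum f ≡ f j
sum-single {f = f} zero off =
  trans (cong (f zero +_) (sum-zero λ i → off (suc i) λ ())) (+-identityʳ _)
sum-single {f = f} (suc j) off =
  cong₂ _+_ (off zero λ ()) (sum-single j λ i i≢j → off (suc i) (i≢j ∘ suc-injective))

term≤sum : (f : Fin n → ℕ) → ∀ j → f j ≤ sum f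
term≤sum f zero    = m≤m+n _ _
term≤sum f (suc j) = ≤-trans (term≤sum (f ∘ suc) j) (m≤n+m _ _)

𝟙 : Dec A → ℕ
𝟙 d = if does d then 1 else 0

𝟙-yes : (d : Dec A) → A → 𝟙 d ≡ 1
𝟙-yes (yes _) _ = refl
𝟙-yes (no ¬x) x = contradiction x ¬x

𝟙-no : (d : Dec A) → ¬ A → 𝟙 d ≡ 0
𝟙-no (yes x) ¬x = contradiction x ¬x
𝟙-no (no _)  _  = refl

𝟙≤ : (d : Dec A) {k : ℕ} → (A → 1 ≤ k) → 𝟙 d ≤ k
𝟙≤ (yes x) 1≤k = 1≤k x
𝟙≤ (no _)  1≤k = z≤n

𝟙-mono : (d : Dec A) (e : Dec B) → (A → B) → 𝟙 d ≤ 𝟙 e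
𝟙-mono d e A⇒B = 𝟙≤ d λ x → ≤-reflexive (sym (𝟙-yes e (A⇒B x)))

𝟙*-mono : (d : Dec A) {x y : ℕ} → (A → x ≤ y) → 𝟙 d * x ≤ 𝟙 d * y
𝟙*-mono (yes p) x≤y = +-monoˡ-≤ 0 (x≤y p)
𝟙*-mono (no _)  x≤y = z≤n

𝟙*𝟙-no : (d : Dec A) (e : Dec B) → ¬ (A × B) → 𝟙 d * 𝟙 e ≡ 0
𝟙*𝟙-no (no _)  e ¬AB = refl
𝟙*𝟙-no (yes x) e ¬AB = trans (+-identityʳ _) (𝟙-no e λ y → ¬AB (x , y))

𝟙-× : (d : Dec A) (e : Dec B) → 𝟙 d * 𝟙 e ≡ 𝟙 (d ×-dec e)
𝟙-× (no _)  e       = refl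
𝟙-× (yes _) (no _)  = refl
𝟙-× (yes _) (yes _) = refl

∣p∣≡sum : (p : Subset n) → ∣ p ∣ ≡ sum (λ v → 𝟙 (v ∈? p))
∣p∣≡sum []            = refl
∣p∣≡sum (inside  ∷ p) = cong suc (∣p∣≡sum p)
∣p∣≡sum (outside ∷ p) = ∣p∣≡sum p

-- Induction on `m`: the image of `zero` is struck from `Q`, which lowers the right-hand sum and
-- leaves the other images available. The map `f` takes the proof of `P i` because its value may be
-- read off from that proof.
count-injection : ∀ {P : Fin m → Set a} {Q : Fin n → Set b} (P? : ∀ i → Dec (P i)) (Q? : ∀ j → Dec (Q j)) →
  (f : ∀ i → P i → Fin n) → (∀ i p → Q (f i p)) →
  (∀ i j p q → f i p ≡ f j q → i ≡ j) → sum (λ i → 𝟙 (P? i)) ≤ sum (λ j → 𝟙 (Q? j))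
count-injection {m = zero} P? Q? f Qf inj = z≤n
count-injection {m = suc m} {n = n} {Q = Q} P? Q? f Qf inj with P? zero
... | no _  = count-injection (P? ∘ suc) Q? (f ∘ suc) (Qf ∘ suc)
                (λ i j p q → suc-injective ∘ inj (suc i) (suc j) p q)
... | yes p = ≤-trans
    (s≤s (count-injection (P? ∘ suc) Q′? (f ∘ suc)
      (λ i q → Qf (suc i) q , λ eq → contradiction (inj zero (suc i) p q (sym eq)) λ ())
      (λ i j p q → suc-injective ∘ inj (suc i) (suc j) p q)))
    (sum-mono-< (λ j → 𝟙-mono (Q′? j) (Q? j) proj₁) y
      (subst₂ _<_ (sym (𝟙-no (Q′? y) (λ q → proj₂ q refl))) (sym (𝟙-yes (Q? y) (Qf zero p))) ≤-refl))
  where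
  y : Fin n
  y = f zero p
  Q′? : ∀ j → Dec (Q j × j ≢ y)
  Q′? j = Q? j ×-dec ¬? (j ≟ y)

-- Provides the index type `Fin size` for the parts of a star partitioning, with one index per
-- representative.
enumerate : ∀ {P : Fin n → Set} → (∀ v → Dec (P v)) →
  ∃ λ m → Σ (Fin m → Fin n) λ e → (∀ i → P (e i)) × (∀ {i j} → e i ≡ e j → i ≡ j) × (∀ v → P v → ∃ λ i → e i ≡ v)
enumerate {n = zero} P? = 0 , (λ ()) , (λ ()) , (λ { {()} }) , λ ()
enumerate {n = suc n} {P} P? with enumerate (P? ∘ suc) | P? zero
... | m , e , Pe , inj , surj | no ¬p =
  m , suc ∘ e , Pe , inj ∘ suc-injective ,
  λ { zero q → contradiction q ¬p ; (suc v) q → let i , eq = surj v q in i , cong suc eq }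
... | m , e , Pe , inj , surj | yes p = suc m , e′ , Pe′ , inj′ , surj′
  where
  e′ : Fin (suc m) → Fin (suc n)
  e′ zero    = zero
  e′ (suc i) = suc (e i)
  Pe′ : ∀ i → P (e′ i)
  Pe′ zero    = p
  Pe′ (suc i) = Pe i
  inj′ : ∀ {i j} → e′ i ≡ e′ j → i ≡ j
  inj′ {zero}  {zero}  _  = refl
  inj′ {suc i} {suc j} eq = cong suc (inj (suc-injective eq))
  surj′ : ∀ v → P v → ∃ λ i → e′ i ≡ v
  surj′ zero    _ = zero , refl
  surj′ (suc v) q = let i , eq = surj v q in suc i , cong suc eq

-- Subsets of Fin n

⟪_⟫ : {P : Fin n → Set} → (∀ v → Dec (P v)) → Subset n
⟪ P? ⟫ = tabulate (does ∘ P?)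

∈⟪⟫⁺ : {P : Fin n → Set} (P? : ∀ v → Dec (P v)) → ∀ {v} → P v → v ∈ ⟪ P? ⟫
∈⟪⟫⁺ P? {v} p = lookup⇒[]= v _ (trans (lookup∘tabulate _ v) (dec-true (P? v) p))

∈⟪⟫⁻ : {P : Fin n → Set} (P? : ∀ v → Dec (P v)) → ∀ {v} → v ∈ ⟪ P? ⟫ → P v
∈⟪⟫⁻ P? {v} v∈ with P? v | trans (sym (lookup∘tabulate (does ∘ P?) v)) ([]=⇒lookup v∈)
... | yes p | _ = p

∣⟪⟫∣ : {P : Fin n → Set} (P? : ∀ v → Dec (P v)) → ∣ ⟪ P? ⟫ ∣ ≡ sum λ v → 𝟙 (P? v)
∣⟪⟫∣ {zero}  P? = refl
∣⟪⟫∣ {suc n} P? with does (P? zero)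
... | true  = cong suc (∣⟪⟫∣ (P? ∘ suc))
... | false = ∣⟪⟫∣ (P? ∘ suc)

⟦⟧-≡ : {p : Subset n} {x y : Σ (Fin n) (_∈ p)} → proj₁ x ≡ proj₁ y → x ≡ y
⟦⟧-≡ {x = x , x∈p} {_ , x∈p′} refl = cong (x ,_) ([]=-irrelevant x∈p x∈p′)

∣p∣≡1⇒≡ : {p : Subset n} {x y : Fin n} → ∣ p ∣ ≡ 1 → x ∈ p → y ∈ p → x ≡ y
∣p∣≡1⇒≡ {p = p} {x} {y} ∣p∣≡1 x∈p y∈p with x ≟ y
... | yes x≡y = x≡y
... | no  x≢y = contradiction (≤-trans two (≤-reflexive ∣p∣≡1)) λ { (s≤s ()) }
  where
  two : 2 ≤ ∣ p ∣
  two = ≤-trans (s≤s (≤-trans (s≤s z≤n) (x∈p⇒∣p-x∣<∣p∣ (x∈p∧x≢y⇒x∈p-y x∈p x≢y)))) (x∈p⇒∣p-x∣<∣p∣ y∈p)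

unique⇒∣p∣≡1 : {p : Subset n} {x : Fin n} → x ∈ p → (∀ {y} → y ∈ p → y ≡ x) → ∣ p ∣ ≡ 1
unique⇒∣p∣≡1 {p = p} {x} x∈p uniq = trans (cong ∣_∣ (⊆-antisym p⊆ ⊆p)) (∣⁅x⁆∣≡1 x)
  where
  p⊆ : ∀ {y} → y ∈ p → y ∈ ⁅ x ⁆
  p⊆ y∈p = subst (_∈ ⁅ x ⁆) (sym (uniq y∈p)) (x∈⁅x⁆ x)
  ⊆p : ∀ {y} → y ∈ ⁅ x ⁆ → y ∈ p
  ⊆p y∈ = subst (_∈ p) (sym (x∈⁅y⁆⇒x≡y x y∈)) x∈p

∈pair⁻ : {u v w : Fin n} → w ∈ ⁅ u ⁆ ∪ ⁅ v ⁆ → w ≡ u ⊎ w ≡ v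
∈pair⁻ {u = u} {v} w∈ with x∈p∪q⁻ ⁅ u ⁆ ⁅ v ⁆ w∈
... | inj₁ w∈u = inj₁ (x∈⁅y⁆⇒x≡y u w∈u)
... | inj₂ w∈v = inj₂ (x∈⁅y⁆⇒x≡y v w∈v)

∈pairˡ : {u v : Fin n} → u ∈ ⁅ u ⁆ ∪ ⁅ v ⁆
∈pairˡ = x∈p∪q⁺ (inj₁ (x∈⁅x⁆ _))

∈pairʳ : {u v : Fin n} → v ∈ ⁅ u ⁆ ∪ ⁅ v ⁆
∈pairʳ = x∈p∪q⁺ (inj₂ (x∈⁅x⁆ _))

∣p∪q∣≤∣p∣+∣q∣ : (p q : Subset n) → ∣ p ∪ q ∣ ≤ ∣ p ∣ + ∣ q ∣
∣p∪q∣≤∣p∣+∣q∣ []            []            = z≤n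
∣p∪q∣≤∣p∣+∣q∣ (inside  ∷ p) (inside  ∷ q) = s≤s (≤-trans (∣p∪q∣≤∣p∣+∣q∣ p q) (+-monoʳ-≤ ∣ p ∣ (n≤1+n ∣ q ∣)))
∣p∪q∣≤∣p∣+∣q∣ (inside  ∷ p) (outside ∷ q) = s≤s (∣p∪q∣≤∣p∣+∣q∣ p q)
∣p∪q∣≤∣p∣+∣q∣ (outside ∷ p) (inside  ∷ q) = ≤-trans (s≤s (∣p∪q∣≤∣p∣+∣q∣ p q)) (≤-reflexive (sym (+-suc ∣ p ∣ ∣ q ∣)))
∣p∪q∣≤∣p∣+∣q∣ (outside ∷ p) (outside ∷ q) = ∣p∪q∣≤∣p∣+∣q∣ p q

∣pair∣≤2 : (u v : Fin n) → ∣ ⁅ u ⁆ ∪ ⁅ v ⁆ ∣ ≤ 2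
∣pair∣≤2 u v = subst₂ (λ k l → ∣ ⁅ u ⁆ ∪ ⁅ v ⁆ ∣ ≤ k + l) (∣⁅x⁆∣≡1 u) (∣⁅x⁆∣≡1 v) (∣p∪q∣≤∣p∣+∣q∣ ⁅ u ⁆ ⁅ v ⁆)

-- Rooting a tree

least : {P : ℕ → Set} → (∀ k → Dec (P k)) → ∀ k → P k → ∃ λ l → P l × (∀ j → P j → l ≤ j)
least P? k Pk with P? 0
least P? k       Pk | yes P0 = 0 , P0 , λ _ _ → z≤n
least P? zero    Pk | no ¬P0 = contradiction Pk ¬P0
least P? (suc k) Pk | no ¬P0 with least (P? ∘ suc) k Pk
... | l , Pl , l≤ = suc l , Pl , λ { zero P0 → contradiction P0 ¬P0 ; (suc j) Pj → s≤s (l≤ j Pj) }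

module _ {n : ℕ} (G : Graph n) where
  open Graph G renaming (sym to adj-sym)

  leaf-unique : ∀ {u v w} → IsLeaf G u → Adj u v → Adj u w → v ≡ w
  leaf-unique {u} leaf uv uw = ∣p∣≡1⇒≡ leaf (∈⟪⟫⁺ (adj? u) uv) (∈⟪⟫⁺ (adj? u) uw)

  unique-leaf : ∀ {u v} → Adj u v → (∀ {w} → Adj u w → w ≡ v) → IsLeaf G u
  unique-leaf {u} uv uniq = unique⇒∣p∣≡1 (∈⟪⟫⁺ (adj? u) uv) (uniq ∘ ∈⟪⟫⁻ (adj? u))

  -- The fields follow those of `Cycle`, so that one closing edge turns a long enough path into a
  -- cycle. The relation `R` is a parameter because the paths needed later avoid a given edge.
  record SimplePath (R : Fin n → Fin n → Set) (x y : Fin n) : Set where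
    field
      len       : ℕ
      c         : Fin (suc len) → Fin n
      injective : ∀ {i j} → c i ≡ c j → i ≡ j
      step      : ∀ i → R (c (inject₁ i)) (c (suc i))
      start     : c zero ≡ x
      end       : c (fromℕ len) ≡ y

  module _ {R : Fin n → Fin n → Set} where
    open SimplePath

    suffix : ∀ {x y} (p : SimplePath R x y) (i : Fin (suc (len p))) → SimplePath R (c p i) y
    suffix p zero = record { SimplePath p ; start = refl }
    suffix p@record { len = suc l } (suc i) = suffix tail i
      where
      tail : SimplePath R (c p (suc zero)) _
      tail = record
        { len       = l
        ; c         = c p ∘ suc
        ; injective = suc-injective ∘ injective p
        ; step      = step p ∘ suc
        ; start     = refl
        ; end       = end p
        }

    cons : ∀ {x z y} → R x z → (p : SimplePath R z y) → (∀ i → c p i ≢ x) → SimplePath R x y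
    cons {x} {z} {y} xRz p x∉p = record
      { len = suc (len p) ; c = c′ ; injective = inj ; step = step′ ; start = refl ; end = end p }
      where
      c′ : Fin (suc (suc (len p))) → Fin n
      c′ zero    = x
      c′ (suc i) = c p i
      inj : ∀ {i j} → c′ i ≡ c′ j → i ≡ j
      inj {zero}  {zero}  _  = refl
      inj {zero}  {suc j} eq = contradiction (sym eq) (x∉p j)
      inj {suc i} {zero}  eq = contradiction eq (x∉p i)
      inj {suc i} {suc j} eq = cong suc (injective p eq)
      step′ : ∀ i → R (c′ (inject₁ i)) (c′ (suc i))
      step′ zero    = subst (R x) (sym (start p)) xRz
      step′ (suc i) = step p i

    -- If the first vertex recurs on the path found for the rest of the walk, that path is cut at
    -- the recurrence; otherwise the vertex is prepended.
    loop-erasure : ∀ {x y} → Star R x y → SimplePath R x y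
    loop-erasure {x} ε = record
      { len = 0 ; c = λ _ → x ; injective = λ { {zero} {zero} _ → refl } ; step = λ () ; start = refl ; end = refl }
    loop-erasure {x} (xRz ◅ walk) with loop-erasure walk
    ... | p with any? (λ i → c p i ≟ x)
    ... | yes (i , eq) = subst (λ x → SimplePath R x _) eq (suffix p i)
    ... | no x∉p       = cons xRz p (λ i eq → x∉p (i , eq))

  -- Loop erasure gives a path from `x` to `y`. Length 0 contradicts irreflexivity and length 1
  -- contradicts `¬ R x y`, so the path has at least 2 edges and the edge `xy` closes it.
  bypass⇒Cycle : ∀ {R : Fin n → Fin n → Set} {x y} → (∀ {u v} → R u v → Adj u v) →
    Adj x y → ¬ R x y → Star R x y → Cycle G
  bypass⇒Cycle {R} {x} {y} R⇒Adj xy ¬xRy walk with loop-erasure walk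
  ... | record { len = 0 ; start = refl ; end = refl } = contradiction xy (irrefl x)
  ... | record { len = 1 ; step = step ; start = refl ; end = refl } = contradiction (step zero) ¬xRy
  ... | record { len = suc (suc l) ; c = c ; injective = inj ; step = step ; start = refl ; end = refl } = record
    { m = suc (suc l) ; 2≤m = s≤s (s≤s z≤n) ; c = c ; injective = inj ; step = R⇒Adj ∘ step ; close = adj-sym xy }

  -- The value of par at the root is junk.
  record Rooting (r : Fin n) : Set where
    field
      par     : Fin n → Fin n
      dep     : Fin n → ℕ
      par-adj : ∀ {v} → v ≢ r → Adj v (par v)
      dep-par : ∀ {v} → v ≢ r → dep v ≡ suc (dep (par v))

    Child : Fin n → Fin n → Set
    Child v u = u ≢ r × par u ≡ v

    field
      edge    : ∀ {u v} → Adj u v → Child u v ⊎ Child v u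

    child? : ∀ v u → Dec (Child v u)
    child? v u = ¬? (u ≟ r) ×-dec (par u ≟ v)

  -- An edge xy outside the spanning tree given by par would be bypassed by the
  -- tree walks from x and y to the root.
  spanning⇒Rooting : ¬ Cycle G → ∀ {r} (par : Fin n → Fin n) (dep : Fin n → ℕ) →
    (∀ {v} → v ≢ r → Adj v (par v)) → (∀ {v} → v ≢ r → dep v ≡ suc (dep (par v))) → Rooting r
  spanning⇒Rooting acyclic {r} par dep par-adj dep-par = record
    { par = par ; dep = dep ; par-adj = par-adj ; dep-par = dep-par ; edge = edge }
    where
    module _ {x y : Fin n} (¬yx : ¬ (y ≢ r × par y ≡ x)) (¬xy : ¬ (x ≢ r × par x ≡ y)) where
      -- Adjacency with the edge `xy` deleted. All parent edges survive the deletion, since neither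
      -- end of `xy` is the parent of the other.
      R : Fin n → Fin n → Set
      R u v = Adj u v × ¬ (u ≡ x × v ≡ y) × ¬ (u ≡ y × v ≡ x)

      toRoot : ∀ k v → dep v ≡ k → Star R v r
      toRoot k v eq with v ≟ r
      ... | yes refl = ε
      toRoot zero v eq | no v≢r = contradiction (trans (sym eq) (dep-par v≢r)) λ ()
      toRoot (suc k) v eq | no v≢r =
        (par-adj v≢r ,
         (λ { (refl , p) → ¬xy (v≢r , p) }) ,
         (λ { (refl , p) → ¬yx (v≢r , p) }))
        ◅ toRoot k (par v) (cong (_∸ 1) (trans (sym (dep-par v≢r)) eq))

      R-sym : ∀ {u v} → R u v → R v u
      R-sym (uv , ¬a , ¬b) = adj-sym uv , (λ { (p , q) → ¬b (q , p) }) , λ { (p , q) → ¬a (q , p) }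

      walk : Star R x y
      walk = toRoot _ x refl ◅◅ reverse R-sym (toRoot _ y refl)

    edge : ∀ {u v} → Adj u v → (v ≢ r × par v ≡ u) ⊎ (u ≢ r × par u ≡ v)
    edge {u} {v} uv with ¬? (v ≟ r) ×-dec (par v ≟ u) | ¬? (u ≟ r) ×-dec (par u ≟ v)
    ... | yes p | _     = inj₁ p
    ... | no _  | yes p = inj₂ p
    ... | no ¬p | no ¬q = contradiction
      (bypass⇒Cycle {R = R ¬p ¬q} proj₁ uv (λ uRv → proj₁ (proj₂ uRv) (refl , refl)) (walk ¬p ¬q)) acyclic

  module _ (tree : IsTree G) (r : Fin n) where
    open IsTree tree

    -- A length-indexed form of `Star Adj v r`: it is decidable for each `k`, so a least `k` can be
    -- found, the distance from the root.
    Reach : ℕ → Fin n → Set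
    Reach zero    v = v ≡ r
    Reach (suc k) v = ∃ λ u → Adj v u × Reach k u

    reach? : ∀ k v → Dec (Reach k v)
    reach? zero    v = v ≟ r
    reach? (suc k) v = any? λ u → adj? v u ×-dec reach? k u

    star⇒reach : ∀ {v} → Star Adj v r → ∃ λ k → Reach k v
    star⇒reach ε = 0 , refl
    star⇒reach (vu ◅ walk) = let k , p = star⇒reach walk in suc k , _ , vu , p

    distance : ∀ v → ∃ λ k → Reach k v × (∀ j → Reach j v → k ≤ j)
    distance v = let k , p = star⇒reach (connected v r) in least (λ k → reach? k v) k p

    dist : Fin n → ℕ
    dist v = proj₁ (distance v)

    -- The next vertex of a shortest walk is at distance at most `k` by the rest of that walk, and
    -- not less by minimality at `v`. At the root, `v` itself is a placeholder that makes `parent`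
    -- total.
    closer : ∀ v → ∃ λ u → v ≢ r → Adj v u × dist v ≡ suc (dist u)
    closer v with distance v
    ... | zero  , v≡r , _ = v , λ v≢r → contradiction v≡r v≢r
    ... | suc k , (u , vu , p) , least = u , λ _ → vu , cong suc (≤-antisym k≤ (proj₂ (proj₂ (distance u)) k p))
      where
      k≤ : k ≤ dist u
      k≤ = ≤-pred (least (suc (dist u)) (u , vu , proj₁ (proj₂ (distance u))))

    parent : Fin n → Fin n
    parent v = proj₁ (closer v)

    parent-adj : ∀ {v} → v ≢ r → Adj v (parent v)
    parent-adj v≢r = proj₁ (proj₂ (closer _) v≢r)

    dist-parent : ∀ {v} → v ≢ r → dist v ≡ suc (dist (parent v))
    dist-parent v≢r = proj₂ (proj₂ (closer _) v≢r)

    root : Rooting r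
    root = spanning⇒Rooting acyclic parent dist parent-adj dist-parent

-- Matchings with a 2-colouring

-- The matching edges are u, partner u for u in M. Both colours occur among the
-- matched neighbours of an unmatched vertex, so the colour classes dominate.
record ColouredMatching {n : ℕ} (G : Graph n) : Set₁ where
  open Graph G
  field
    M                 : Fin n → Set
    M?                : ∀ v → Dec (M v)
    partner           : Fin n → Fin n
    partner-adj       : ∀ {u} → M u → Adj u (partner u)
    partner-∉         : ∀ {u} → M u → ¬ M (partner u)
    partner-injective : ∀ {u v} → M u → M v → partner u ≡ partner v → u ≡ v
    col               : Fin n → Bool
    col-partner       : ∀ {u} → M u → col (partner u) ≡ not (col u)

  Matched : Fin n → Set
  Matched v = M v ⊎ ∃ λ u → M u × partner u ≡ v

  field
    unmatched : ∀ v → ¬ Matched v →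
      ∃₂ λ y z → (Matched y × Adj y v × col y ≡ col v) × (Matched z × Adj z v × col z ≡ not (col v))

module _ {n : ℕ} {G : Graph n} (𝓜 : ColouredMatching G) where
  open Graph G renaming (sym to adj-sym)
  open ColouredMatching 𝓜

  size-of-matching : ℕ
  size-of-matching = sum λ v → 𝟙 (M? v)

  matched? : ∀ v → Dec (Matched v)
  matched? v = M? v ⊎-dec any? λ u → M? u ×-dec (partner u ≟ v)

  -- An involution whose orbits are the matching edges and the unmatched vertices. Since it fixes
  -- the latter, a pair of `v` and `mate v` describes the parts of both kinds.
  mate : Fin n → Fin n
  mate v with matched? v
  ... | yes (inj₁ _)       = partner v
  ... | yes (inj₂ (u , _)) = u
  ... | no _               = v

  mate-M : ∀ {v} → M v → mate v ≡ partner v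
  mate-M {v} Mv with matched? v
  ... | yes (inj₁ _)             = refl
  ... | yes (inj₂ (_ , Mu , eq)) = contradiction (subst M (sym eq) Mv) (partner-∉ Mu)
  ... | no ¬m                    = contradiction (inj₁ Mv) ¬m

  mate-partner : ∀ {u} → M u → mate (partner u) ≡ u
  mate-partner {u} Mu with matched? (partner u)
  ... | yes (inj₁ Mp)            = contradiction Mp (partner-∉ Mu)
  ... | yes (inj₂ (_ , Mw , eq)) = partner-injective Mw Mu eq
  ... | no ¬m                    = contradiction (inj₂ (u , Mu , refl)) ¬m

  mate-unmatched : ∀ {v} → ¬ Matched v → mate v ≡ v
  mate-unmatched {v} ¬m with matched? v
  ... | yes m = contradiction m ¬m
  ... | no _  = refl

  mate-involutive : ∀ v → mate (mate v) ≡ v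
  mate-involutive v with matched? v
  ... | yes (inj₁ Mv)            = mate-partner Mv
  ... | yes (inj₂ (_ , Mu , eq)) = trans (mate-M Mu) eq
  ... | no ¬m                    = mate-unmatched ¬m

  mate-matched : ∀ {v} → Matched v → Matched (mate v)
  mate-matched (inj₁ Mv) = inj₂ (_ , Mv , sym (mate-M Mv))
  mate-matched (inj₂ (u , Mu , refl)) = inj₁ (subst M (sym (mate-partner Mu)) Mu)

  mate-adj : ∀ {v} → Matched v → Adj v (mate v)
  mate-adj (inj₁ Mv) = subst (Adj _) (sym (mate-M Mv)) (partner-adj Mv)
  mate-adj (inj₂ (u , Mu , refl)) = subst (Adj _) (sym (mate-partner Mu)) (adj-sym (partner-adj Mu))

  mate-col : ∀ {v} → Matched v → col (mate v) ≡ not (col v)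
  mate-col (inj₁ Mv) = trans (cong col (mate-M Mv)) (col-partner Mv)
  mate-col (inj₂ (u , Mu , refl)) =
    trans (cong col (mate-partner Mu)) (trans (sym (not-involutive _)) (cong not (sym (col-partner Mu))))

  class? : ∀ b v → Dec (Matched v × col v ≡ b)
  class? b v = matched? v ×-dec (col v ≟ᵇ b)

  class : Bool → Subset n
  class b = ⟪ class? b ⟫

  mate-class : ∀ {b v} → v ∈ class b → mate v ∈ class (not b)
  mate-class {b} v∈ = let m , eq = ∈⟪⟫⁻ (class? b) v∈ in
    ∈⟪⟫⁺ (class? (not b)) (mate-matched m , trans (mate-col m) (cong not eq))

  ≡-or-not : ∀ b c → c ≡ b ⊎ not c ≡ b
  ≡-or-not true  true  = inj₁ refl
  ≡-or-not true  false = inj₂ refl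
  ≡-or-not false true  = inj₂ refl
  ≡-or-not false false = inj₁ refl

  -- A matched vertex of the wrong colour is dominated by its mate, an unmatched one by whichever of
  -- its two chosen neighbours has colour `b`.
  class-dominating : ∀ b → IsDominating G (class b)
  class-dominating b v with matched? v | ≡-or-not b (col v)
  ... | yes m | inj₁ eq = inj₁ (∈⟪⟫⁺ (class? b) (m , eq))
  ... | yes m | inj₂ eq =
    inj₂ (mate v , ∈⟪⟫⁺ (class? b) (mate-matched m , trans (mate-col m) eq) , adj-sym (mate-adj m))
  ... | no ¬m | c with unmatched v ¬m | c
  ... | y , z , (my , yv , cy) , _ | inj₁ eq = inj₂ (y , ∈⟪⟫⁺ (class? b) (my , trans cy eq) , yv)
  ... | y , z , _ , (mz , zv , cz) | inj₂ eq = inj₂ (z , ∈⟪⟫⁺ (class? b) (mz , trans cz eq) , zv)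

  class-matching : ∀ b → PerfectMatching G (class b) (class (not b))
  class-matching b = mk⤖ {to = to} (injective , surjective) , λ (v , v∈) → mate-adj (proj₁ (∈⟪⟫⁻ (class? b) v∈))
    where
    to : Σ (Fin n) (_∈ class b) → Σ (Fin n) (_∈ class (not b))
    to (v , v∈) = mate v , mate-class v∈
    injective : ∀ {x y} → to x ≡ to y → x ≡ y
    injective {x , _} {y , _} eq = ⟦⟧-≡
      (trans (sym (mate-involutive x)) (trans (cong (mate ∘ proj₁) eq) (mate-involutive y)))
    surjective : ∀ y → ∃ λ x → ∀ {z} → z ≡ x → to z ≡ y
    surjective (y , y∈) = (mate y , subst (λ c → mate y ∈ class c) (not-involutive b) (mate-class y∈)) ,
      λ { refl → ⟦⟧-≡ (mate-involutive y) }

  -- Every matching edge has exactly one end of each colour. One injection sends a vertex of the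
  -- class to the `M` end of its edge, the other sends an `M` vertex to the end of colour `b`.
  ∣class∣ : ∀ b → ∣ class b ∣ ≡ size-of-matching
  ∣class∣ b = trans (∣⟪⟫∣ (class? b)) (≤-antisym
    (count-injection (class? b) M? end end-M end-injective)
    (count-injection M? (class? b) endpoint endpoint-class endpoint-injective))
    where
    end : ∀ v → Matched v × col v ≡ b → Fin n
    end v (inj₁ _       , _) = v
    end v (inj₂ (u , _) , _) = u
    end-M : ∀ v p → M (end v p)
    end-M v (inj₁ Mv           , _) = Mv
    end-M v (inj₂ (_ , Mu , _) , _) = Mu
    clash : ∀ {u} → M u → col u ≡ b → col (partner u) ≢ b
    clash Mu refl eq = not-¬ refl (sym (trans (sym (col-partner Mu)) eq))
    end-injective : ∀ v w p p′ → end v p ≡ end w p′ → v ≡ w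
    end-injective v w (inj₁ _ , _)              (inj₁ _ , _)               eq   = eq
    end-injective v w (inj₁ Mv , cv)            (inj₂ (u , _ , refl) , cw) refl = contradiction cw (clash Mv cv)
    end-injective v w (inj₂ (u , _ , refl) , cv) (inj₁ Mw , cw)            refl = contradiction cv (clash Mw cw)
    end-injective v w (inj₂ (u , _ , refl) , _) (inj₂ (_ , _ , refl) , _)  refl = refl
    endpoint : ∀ u → M u → Fin n
    endpoint u _ with ≡-or-not b (col u)
    ... | inj₁ _ = u
    ... | inj₂ _ = partner u
    endpoint-class : ∀ u Mu → Matched (endpoint u Mu) × col (endpoint u Mu) ≡ b
    endpoint-class u Mu with ≡-or-not b (col u)
    ... | inj₁ eq = inj₁ Mu , eq
    ... | inj₂ eq = inj₂ (u , Mu , refl) , trans (col-partner Mu) eq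
    endpoint-injective : ∀ u v Mu Mv → endpoint u Mu ≡ endpoint v Mv → u ≡ v
    endpoint-injective u v Mu Mv eq with ≡-or-not b (col u) | ≡-or-not b (col v)
    ... | inj₁ _ | inj₁ _ = eq
    ... | inj₁ _ | inj₂ _ = contradiction (subst M eq Mu) (partner-∉ Mv)
    ... | inj₂ _ | inj₁ _ = contradiction (subst M (sym eq) Mv) (partner-∉ Mu)
    ... | inj₂ _ | inj₂ _ = partner-injective Mu Mv eq

  swap-set : IsSwapSet G (class true)
  swap-set = class-dominating true , class false , class-dominating false , separate ,
    trans (∣class∣ true) (sym (∣class∣ false)) , class-matching true
    where
    separate : Empty (class true ∩ class false)
    separate (v , v∈) with x∈p∩q⁻ (class true) (class false) v∈
    ... | v∈t , v∈f = contradiction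
      (trans (sym (proj₂ (∈⟪⟫⁻ (class? true) v∈t))) (proj₂ (∈⟪⟫⁻ (class? false) v∈f))) λ ()

  -- Star partitionings from coloured matchings

  module _ (triangle-free : ∀ {x y z} → Adj x y → Adj y z → ¬ Adj x z) where

    -- Selects one vertex from each orbit of `mate`, so that no part is listed twice.
    Representative : Fin n → Set
    Representative v = M v ⊎ ¬ Matched v

    pair-representative : ∀ {x y} → Representative x → Representative y → x ≡ mate y → x ≡ y
    pair-representative rx (inj₂ ¬my) eq = trans eq (mate-unmatched ¬my)
    pair-representative (inj₁ Mx) (inj₁ My) eq = contradiction (subst M (trans eq (mate-M My)) Mx) (partner-∉ My)
    pair-representative (inj₂ ¬mx) (inj₁ My) eq = contradiction (inj₂ (_ , My , sym (trans eq (mate-M My)))) ¬mx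

    -- The parts are the orbits of `mate`. An upper bound on the weight suffices, because the lower
    -- bound for all star partitionings turns it into an equality.
    star-partitioning : ∃ λ P → SimpleStarPartitioning.weight P ≤ size-of-matching
    star-partitioning with enumerate (λ v → M? v ⊎-dec ¬? (matched? v))
    ... | size , e , rep , e-injective , e-onto = P , weight≤
      where
      part : Fin size → Subset n
      part i = ⁅ e i ⁆ ∪ ⁅ mate (e i) ⁆

      shared : ∀ {i j v} → v ∈ part i → v ∈ part j → e i ≡ e j
      shared {i} {j} v∈i v∈j with ∈pair⁻ v∈i | ∈pair⁻ v∈j
      ... | inj₁ refl | inj₁ eq   = eq
      ... | inj₁ refl | inj₂ eq   = pair-representative (rep i) (rep j) eq
      ... | inj₂ eq   | inj₁ refl = sym (pair-representative (rep j) (rep i) eq)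
      ... | inj₂ refl | inj₂ eq   = trans (sym (mate-involutive (e i))) (trans (cong mate eq) (mate-involutive (e j)))

      covers : ∀ v → ∃ λ i → v ∈ part i
      covers v with matched? v
      ... | yes (inj₁ Mv) with i , refl ← e-onto v (inj₁ Mv) = i , ∈pairˡ
      ... | yes (inj₂ (u , Mu , refl)) with i , refl ← e-onto u (inj₁ Mu) =
        i , subst (_∈ part i) (mate-M Mu) ∈pairʳ
      ... | no ¬m with i , refl ← e-onto v (inj₂ ¬m) = i , ∈pairˡ

      star : ∀ i → InducesStar G (part i)
      star i = e i , ∈pairˡ , spoke , rim
        where
        other : ∀ {x} → x ∈ part i → x ≢ e i → x ≡ mate (e i)
        other x∈ x≢ = [ (λ eq → contradiction eq x≢) , id ]′ (∈pair⁻ x∈)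
        spoke : ∀ {x} → x ∈ part i → x ≢ e i → Adj (e i) x
        spoke x∈ x≢ with rep i
        ... | inj₁ Me = subst (Adj (e i)) (sym (other x∈ x≢)) (mate-adj (inj₁ Me))
        ... | inj₂ ¬m = contradiction (trans (other x∈ x≢) (mate-unmatched ¬m)) x≢
        rim : ∀ {x y} → x ∈ part i → y ∈ part i → x ≢ e i → y ≢ e i → ¬ Adj x y
        rim {x} x∈ y∈ x≢ y≢ xy = irrefl x (subst (Adj x) (trans (other y∈ y≢) (sym (other x∈ x≢))) xy)

      -- An unmatched vertex has neighbours of two colours, hence at least two neighbours. So a leaf
      -- is matched, and its mate can only be `v`.
      leafPart : ∀ {v ℓ} → Adj v ℓ → IsLeaf G ℓ → (∀ {w} → Adj v w → IsLeaf G w → w ≡ ℓ) →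
        ∃ λ i → part i ≡ ⁅ v ⁆ ∪ ⁅ ℓ ⁆
      leafPart {v} {ℓ} vℓ leaf _ with matched? ℓ
      ... | no ¬m = let y , z , (_ , yℓ , cy) , (_ , zℓ , cz) = unmatched ℓ ¬m in
        contradiction (trans (sym cy) (trans (cong col (leaf-unique G leaf (adj-sym yℓ) (adj-sym zℓ))) cz)) (not-¬ refl)
      ... | yes m with leaf-unique G leaf (mate-adj m) (adj-sym vℓ) | covers ℓ
      ... | refl | i , ℓ∈ with ∈pair⁻ ℓ∈
      ... | inj₁ refl = i , ∪-comm ⁅ ℓ ⁆ ⁅ mate ℓ ⁆
      ... | inj₂ refl = i , cong (λ x → ⁅ x ⁆ ∪ ⁅ ℓ ⁆) (sym (mate-involutive (e i)))

      matched-part : ∀ {y j} → Matched y → y ∈ part j → ∣ part j ∣ ≢ 1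
      matched-part {y} {j} m y∈ ≡1 with ∈pair⁻ y∈
      ... | inj₁ refl = irrefl _ (subst (Adj _) (∣p∣≡1⇒≡ ≡1 ∈pairʳ y∈) (mate-adj m))
      ... | inj₂ refl = irrefl _ (subst (Adj _) (trans (mate-involutive (e j)) (∣p∣≡1⇒≡ ≡1 ∈pairˡ y∈)) (mate-adj m))

      pair-adj : ∀ {y z j} → y ∈ part j → z ∈ part j → y ≢ z → Adj y z
      pair-adj {j = j} y∈ z∈ y≢z with ∈pair⁻ y∈ | ∈pair⁻ z∈
      ... | inj₁ refl | inj₁ refl = contradiction refl y≢z
      ... | inj₁ refl | inj₂ refl = proj₁ (proj₂ (proj₂ (star j))) z∈ (y≢z ∘ sym)
      ... | inj₂ refl | inj₁ refl = adj-sym (proj₁ (proj₂ (proj₂ (star j))) y∈ y≢z)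
      ... | inj₂ refl | inj₂ refl = contradiction refl y≢z

      single : ∀ i → ∣ part i ∣ ≡ 1 → ∃₂ λ j k → j ≢ k
        × AdjacentParts G (part i) (part j) × ∣ part j ∣ ≢ 1
        × AdjacentParts G (part i) (part k) × ∣ part k ∣ ≢ 1
      single i ≡1 with rep i
      ... | inj₁ Me = contradiction ≡1 (matched-part (inj₁ Me) (∈pairˡ {u = e i}))
      ... | inj₂ ¬m with unmatched (e i) ¬m
      ... | y , z , (my , yv , cy) , (mz , zv , cz) with covers y | covers z
      ... | j , y∈ | k , z∈ = j , k , apart ,
        (e i , y , ∈pairˡ , y∈ , adj-sym yv) , matched-part my y∈ ,
        (e i , z , ∈pairˡ , z∈ , adj-sym zv) , matched-part mz z∈
        where
        -- The two neighbours differ in colour, so they are distinct; in a common part they would be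
        -- adjacent and form a triangle with `e i`.
        apart : j ≢ k
        apart refl = triangle-free yv (adj-sym zv)
          (pair-adj y∈ z∈ λ { refl → not-¬ refl (trans (sym cy) cz) })

      P : SimpleStarPartitioning G
      P = record
        { size     = size
        ; part     = part
        ; nonempty = λ i → e i , ∈pairˡ
        ; disjoint = λ {i} {j} i≢j (v , v∈) →
            let v∈i , v∈j = x∈p∩q⁻ (part i) (part j) v∈ in i≢j (e-injective (shared v∈i v∈j))
        ; covers   = covers
        ; star     = star
        ; leafPart = leafPart
        ; single   = single
        }

      part-weight : ∀ i → ∣ part i ∣ ∸ 1 ≤ 𝟙 (M? (e i))
      part-weight i with rep i
      ... | inj₁ Me = ≤-trans (∸-monoˡ-≤ 1 (∣pair∣≤2 (e i) (mate (e i)))) (≤-reflexive (sym (𝟙-yes (M? (e i)) Me)))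
      ... | inj₂ ¬m = subst (λ k → k ∸ 1 ≤ 𝟙 (M? (e i))) (sym ≡1) z≤n
        where
        ≡1 : ∣ part i ∣ ≡ 1
        ≡1 = unique⇒∣p∣≡1 ∈pairˡ λ y∈ → [ id , (λ eq → trans eq (mate-unmatched ¬m)) ]′ (∈pair⁻ y∈)

      weight≤ : SimpleStarPartitioning.weight P ≤ size-of-matching
      weight≤ = ≤-trans (sum-mono-≤ part-weight)
        (count-injection (M? ∘ e) M? (λ i _ → e i) (λ _ m → m) (λ _ _ _ _ → e-injective))

-- Rooted trees

module Rooted {n : ℕ} (G : Graph n) {r : Fin n} (ρ : Rooting G r) where
  open Graph G renaming (sym to adj-sym)
  open Rooting ρ

  child-adj : ∀ {v u} → Child v u → Adj u v
  child-adj (u≢r , refl) = par-adj u≢r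

  child-dep : ∀ {v u} → Child v u → dep u ≡ suc (dep v)
  child-dep (u≢r , refl) = dep-par u≢r

  -- Depth grows along `Child` and is bounded by `sum dep`, so the invariant `sum dep < dep v + h`
  -- is impossible once the fuel `h` is zero.
  child-induction : ∀ {a} (P : Fin n → Set a) → (∀ v → (∀ {u} → Child v u → P u) → P v) → ∀ v → P v
  child-induction P step v = go (suc (sum dep)) v (m≤n+m _ (dep v))
    where
    go : ∀ h v → sum dep < dep v + h → P v
    go zero v lt = contradiction (term≤sum dep v) (<⇒≱ (subst (sum dep <_) (+-identityʳ (dep v)) lt))
    go (suc h) v lt = step v λ {u} vu →
      go h u (subst (sum dep <_) (trans (+-suc (dep v) h) (cong (_+ h) (sym (child-dep vu)))) lt)

  childless-vertex : ∀ v → v ≢ r → ∃ λ u → u ≢ r × (∀ {w} → ¬ Child u w)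
  childless-vertex = child-induction _ λ v ih v≢r → search v ih v≢r
    where
    search : ∀ v → (∀ {u} → Child v u → u ≢ r → ∃ λ u → u ≢ r × (∀ {w} → ¬ Child u w)) →
      v ≢ r → ∃ λ u → u ≢ r × (∀ {w} → ¬ Child u w)
    search v ih v≢r with any? (child? v)
    ... | yes (u , vu) = ih vu (proj₁ vu)
    ... | no  ¬∃       = v , v≢r , λ vw → ¬∃ (_ , vw)

  -- Subtrees and sums over them

  infix 4 _⊑_ _⊑?_

  -- Membership in the subtree of `v`, witnessed by climbing from `u`. The premise `u ≢ r` keeps the
  -- climb from using the junk parent of the root.
  data _⊑_ : Fin n → Fin n → Set where
    here : ∀ {v} → v ⊑ v
    up   : ∀ {u v} → u ≢ r → par u ⊑ v → u ⊑ v

  _⊑?_ : ∀ u v → Dec (u ⊑ v)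
  u ⊑? v = go (dep u) u refl
    where
    go : ∀ d u → dep u ≡ d → Dec (u ⊑ v)
    go d u eq with u ≟ v | u ≟ r
    go d       u eq | yes refl | _        = yes here
    go d       u eq | no  u≢v  | yes refl = no λ { here → u≢v refl ; (up u≢r _) → u≢r refl }
    go zero    u eq | no  u≢v  | no u≢r   = contradiction (trans (sym eq) (dep-par u≢r)) λ ()
    go (suc d) u eq | no  u≢v  | no u≢r   =
      map′ (up u≢r) (λ { here → contradiction refl u≢v ; (up _ p) → p })
        (go d (par u) (cong (_∸ 1) (trans (sym (dep-par u≢r)) eq)))

  ⊑-dep : ∀ {u v} → u ⊑ v → dep v ≤ dep u
  ⊑-dep here        = ≤-refl
  ⊑-dep (up u≢r p) = ≤-trans (⊑-dep p) (≤-trans (n≤1+n _) (≤-reflexive (sym (dep-par u≢r))))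

  ⊑-root : ∀ u → u ⊑ r
  ⊑-root u = go (dep u) u refl
    where
    go : ∀ d u → dep u ≡ d → u ⊑ r
    go d u eq with u ≟ r
    go d       u eq | yes refl = here
    go zero    u eq | no u≢r   = contradiction (trans (sym eq) (dep-par u≢r)) λ ()
    go (suc d) u eq | no u≢r   = up u≢r (go d (par u) (cong (_∸ 1) (trans (sym (dep-par u≢r)) eq)))

  ⊑-child : ∀ {u v w} → Child v w → u ⊑ w → u ⊑ v
  ⊑-child (w≢r , refl) here       = up w≢r here
  ⊑-child vw           (up u≢r p) = up u≢r (⊑-child vw p)

  ⋢-child : ∀ {v w} → Child v w → ¬ v ⊑ w
  ⋢-child vw v⊑w = <⇒≱ (≤-reflexive (sym (child-dep vw))) (⊑-dep v⊑w)

  ⊑⇒child : ∀ {u v} → u ⊑ v → u ≢ v → ∃ λ w → Child v w × u ⊑ w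
  ⊑⇒child here u≢v = contradiction refl u≢v
  ⊑⇒child {u} {v} (up u≢r p) u≢v with par u ≟ v
  ... | yes eq = u , (u≢r , eq) , here
  ... | no neq = let w , vw , q = ⊑⇒child p neq in w , vw , up u≢r q

  ⊑-child-unique : ∀ {u v w w′} → Child v w → Child v w′ → u ⊑ w → u ⊑ w′ → w ≡ w′
  ⊑-child-unique vw vw′ here here = refl
  ⊑-child-unique (_ , refl) vw′ here (up _ q) = contradiction q (⋢-child vw′)
  ⊑-child-unique vw (_ , refl) (up _ p) here = contradiction p (⋢-child vw)
  ⊑-child-unique vw vw′ (up _ p) (up _ q) = ⊑-child-unique vw vw′ p q

  -- Every edge joins a child to its parent, and a subtree contains the children of its vertices; so
  -- it can be entered only from above, at its top.
  ⊑-entry : ∀ {x y v} → Adj x y → y ⊑ v → ¬ x ⊑ v → y ≡ v × v ≢ r × x ≡ par v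
  ⊑-entry xy y⊑v x⋢v with edge xy
  ⊑-entry xy here     x⋢v | inj₁ (y≢r , refl) = refl , y≢r , refl
  ⊑-entry xy (up _ p) x⋢v | inj₁ (y≢r , refl) = contradiction p x⋢v
  ⊑-entry xy y⊑v      x⋢v | inj₂ (x≢r , refl) = contradiction (up x≢r y⊑v) x⋢v

  -- Summing over all vertices with an indicator makes the value at the root the plain total;
  -- `cnt-unfold` recovers the recursion over children that the inductions need.
  cnt below : (Fin n → ℕ) → Fin n → ℕ
  cnt c v = sum λ u → 𝟙 (u ⊑? v) * c u
  below c v = sum λ w → 𝟙 (child? v w) * cnt c w

  -- A proper descendant of `v` lies in the subtree of exactly one child.
  𝟙-⊑ : ∀ u v → 𝟙 (u ⊑? v) ≡ 𝟙 (u ≟ v) + sum λ w → 𝟙 (child? v w) * 𝟙 (u ⊑? w)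
  𝟙-⊑ u v = go (u ≟ v) (u ⊑? v)
    where
    open ≡-Reasoning
    F : Fin n → ℕ
    F w = 𝟙 (child? v w) * 𝟙 (u ⊑? w)
    F-zero : ∀ w → ¬ (Child v w × u ⊑ w) → F w ≡ 0
    F-zero w = 𝟙*𝟙-no (child? v w) (u ⊑? w)
    go : (d : Dec (u ≡ v)) (e : Dec (u ⊑ v)) → 𝟙 e ≡ 𝟙 d + sum F
    go (yes refl) e = trans (𝟙-yes e here)
      (cong suc (sym (sum-zero {f = F} λ w → F-zero w λ (vw , v⊑w) → ⋢-child vw v⊑w)))
    go (no u≢v) (no u⋢v) = sym (sum-zero {f = F} λ w → F-zero w λ (vw , u⊑w) → u⋢v (⊑-child vw u⊑w))
    go (no u≢v) (yes u⊑v) with ⊑⇒child u⊑v u≢v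
    ... | w , vw , u⊑w = sym (begin
      sum F                        ≡⟨ sum-single {f = F} w (λ i i≢w → F-zero i λ (vi , u⊑i) → i≢w (⊑-child-unique vi vw u⊑i u⊑w)) ⟩
      𝟙 (child? v w) * 𝟙 (u ⊑? w)  ≡⟨ cong₂ _*_ (𝟙-yes (child? v w) vw) (𝟙-yes (u ⊑? w) u⊑w) ⟩
      1                            ∎)

  -- Double counting: after the split by `𝟙-⊑`, the sums over descendants and over children are
  -- exchanged.
  cnt-unfold : ∀ c v → cnt c v ≡ c v + below c v
  cnt-unfold c v = begin
    sum (λ u → 𝟙 (u ⊑? v) * c u)
      ≡⟨ sum-cong-≗ (λ u → trans (cong (_* c u) (𝟙-⊑ u v)) (*-distribʳ-+ (c u) (𝟙 (u ≟ v)) _)) ⟩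
    sum (λ u → 𝟙 (u ≟ v) * c u + S u * c u)
      ≡⟨ ∑-distrib-+ (λ u → 𝟙 (u ≟ v) * c u) (λ u → S u * c u) ⟩
    sum (λ u → 𝟙 (u ≟ v) * c u) + sum (λ u → S u * c u)
      ≡⟨ cong₂ _+_ self others ⟩
    c v + below c v ∎
    where
    open ≡-Reasoning
    S : Fin n → ℕ
    S u = sum λ w → 𝟙 (child? v w) * 𝟙 (u ⊑? w)
    self : sum (λ u → 𝟙 (u ≟ v) * c u) ≡ c v
    self = trans (sum-single v λ u u≢v → cong (_* c u) (𝟙-no (u ≟ v) u≢v))
      (trans (cong (_* c v) (𝟙-yes (v ≟ v) refl)) (+-identityʳ (c v)))
    others : sum (λ u → S u * c u) ≡ below c v
    others = begin
      sum (λ u → S u * c u)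
        ≡⟨ sum-cong-≗ (λ u → *-distribʳ-sum (c u) (λ w → 𝟙 (child? v w) * 𝟙 (u ⊑? w))) ⟩
      sum (λ u → sum λ w → 𝟙 (child? v w) * 𝟙 (u ⊑? w) * c u)
        ≡⟨ ∑-comm (λ u w → 𝟙 (child? v w) * 𝟙 (u ⊑? w) * c u) ⟩
      sum (λ w → sum λ u → 𝟙 (child? v w) * 𝟙 (u ⊑? w) * c u)
        ≡⟨ sum-cong-≗ (λ w → sum-cong-≗ λ u → *-assoc (𝟙 (child? v w)) (𝟙 (u ⊑? w)) (c u)) ⟩
      sum (λ w → sum λ u → 𝟙 (child? v w) * (𝟙 (u ⊑? w) * c u))
        ≡⟨ sum-cong-≗ (λ w → *-distribˡ-sum (𝟙 (child? v w)) (λ u → 𝟙 (u ⊑? w) * c u)) ⟨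
      below c v ∎

  cnt-root : ∀ c → cnt c r ≡ sum c
  cnt-root c = sum-cong-≗ λ u → trans (cong (_* c u) (𝟙-yes (u ⊑? r) (⊑-root u))) (+-identityʳ (c u))

  below-mono-≤ : ∀ {c d v} → (∀ {u} → Child v u → cnt c u ≤ cnt d u) → below c v ≤ below d v
  below-mono-≤ {v = v} c≤d = sum-mono-≤ λ u → 𝟙*-mono (child? v u) c≤d

  below-mono-< : ∀ {c d v} → (∀ {u} → Child v u → cnt c u ≤ cnt d u) →
    ∀ {w} → Child v w → cnt c w < cnt d w → below c v < below d v
  below-mono-< {v = v} c≤d {w} vw c<d = sum-mono-< (λ u → 𝟙*-mono (child? v u) c≤d) w
    (subst₂ _<_ (eq _) (eq _) c<d)
    where
    eq : ∀ k → k ≡ 𝟙 (child? v w) * k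
    eq k = sym (trans (cong (_* k) (𝟙-yes (child? v w) vw)) (+-identityʳ k))

  -- Vertex types

  data Type : Set where
    L X₁ X₂ Z : Type

  infix 4 _≟ᵗ_
  _≟ᵗ_ : (s t : Type) → Dec (s ≡ t)
  L  ≟ᵗ L  = yes refl
  L  ≟ᵗ X₁ = no λ ()
  L  ≟ᵗ X₂ = no λ ()
  L  ≟ᵗ Z  = no λ ()
  X₁ ≟ᵗ L  = no λ ()
  X₁ ≟ᵗ X₁ = yes refl
  X₁ ≟ᵗ X₂ = no λ ()
  X₁ ≟ᵗ Z  = no λ ()
  X₂ ≟ᵗ L  = no λ ()
  X₂ ≟ᵗ X₁ = no λ ()
  X₂ ≟ᵗ X₂ = yes refl
  X₂ ≟ᵗ Z  = no λ ()
  Z  ≟ᵗ L  = no λ ()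
  Z  ≟ᵗ X₁ = no λ ()
  Z  ≟ᵗ X₂ = no λ ()
  Z  ≟ᵗ Z  = yes refl

  -- The second premise of `ruleL` covers both ways to have type `L`: there is an `X₁` child, or
  -- there is no `Z` child and the premise is vacuous.
  data Rule (t : Fin n → Type) (v : Fin n) : Type → Set where
    ruleZ  : ∀ {u} → Child v u → t u ≡ L → Rule t v Z
    ruleL  : (∀ {u} → Child v u → t u ≢ L) →
             (∀ {y} → Child v y → t y ≡ Z → ∃ λ w → Child v w × t w ≡ X₁) → Rule t v L
    ruleX₁ : (∀ {u} → Child v u → t u ≢ L) → (∀ {u} → Child v u → t u ≢ X₁) →
             ∀ {y} → Child v y → t y ≡ Z → (∀ {u} → Child v u → t u ≡ Z → u ≡ y) → Rule t v X₁
    ruleX₂ : (∀ {u} → Child v u → t u ≢ L) → (∀ {u} → Child v u → t u ≢ X₁) →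
             ∀ {y z} → Child v y → t y ≡ Z → Child v z → t z ≡ Z → z ≢ y → Rule t v X₂

  rule-cong : ∀ {s t v k} → (∀ {u} → Child v u → s u ≡ t u) → Rule s v k → Rule t v k
  rule-cong s≡t (ruleZ c p) = ruleZ c (trans (sym (s≡t c)) p)
  rule-cong s≡t (ruleL ¬L X) = ruleL (λ c p → ¬L c (trans (s≡t c) p))
    λ c p → let w , cw , q = X c (trans (s≡t c) p) in w , cw , trans (sym (s≡t cw)) q
  rule-cong s≡t (ruleX₁ ¬L ¬X c p uniq) = ruleX₁ (λ c p → ¬L c (trans (s≡t c) p)) (λ c p → ¬X c (trans (s≡t c) p))
    c (trans (sym (s≡t c)) p) λ c p → uniq c (trans (s≡t c) p)
  rule-cong s≡t (ruleX₂ ¬L ¬X c p d q neq) = ruleX₂ (λ c p → ¬L c (trans (s≡t c) p)) (λ c p → ¬X c (trans (s≡t c) p))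
    c (trans (sym (s≡t c)) p) d (trans (sym (s≡t d)) q) neq

  apply-rule : ∀ t v → ∃ (Rule t v)
  apply-rule t v with any? (λ u → child? v u ×-dec (t u ≟ᵗ L))
  ... | yes (_ , c , p) = Z , ruleZ c p
  ... | no ¬L with any? (λ u → child? v u ×-dec (t u ≟ᵗ X₁))
  ... | yes (w , c , p) = L , ruleL (λ c p → ¬L (_ , c , p)) λ _ _ → w , c , p
  ... | no ¬X with any? (λ u → child? v u ×-dec (t u ≟ᵗ Z))
  ... | no ¬Z = L , ruleL (λ c p → ¬L (_ , c , p)) λ c p → contradiction (_ , c , p) ¬Z
  ... | yes (y , c , p) with any? (λ u → (child? v u ×-dec (t u ≟ᵗ Z)) ×-dec ¬? (u ≟ y))
  ... | yes (z , (d , q) , z≢y) = X₂ , ruleX₂ (λ c p → ¬L (_ , c , p)) (λ c p → ¬X (_ , c , p)) c p d q z≢y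
  ... | no ¬Z₂ = X₁ , ruleX₁ (λ c p → ¬L (_ , c , p)) (λ c p → ¬X (_ , c , p)) c p
    λ {u} d q → decidable-stable (u ≟ y) λ u≢y → ¬Z₂ (u , (d , q) , u≢y)

  -- The fuel `suc (sum dep) ∸ dep v` at `v` is one more than at its children, so the rule at `v`
  -- sees the final types of its children.
  typing : ∃ λ t → ∀ v → Rule t v (t v)
  typing = type , sound
    where
    typeAt : ℕ → Fin n → Type
    -- A default that influences no type: fuel zero belongs to children of a vertex of depth
    -- `sum dep`, which has none.
    typeAt zero    v = L
    typeAt (suc h) v = proj₁ (apply-rule (typeAt h) v)
    type : Fin n → Type
    type v = typeAt (suc (sum dep) ∸ dep v) v
    sound : ∀ v → Rule type v (type v)
    sound v = subst (λ h → Rule type v (typeAt h v)) (sym (+-∸-assoc 1 (term≤sum dep v)))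
      (rule-cong (λ {u} c → cong (λ k → typeAt k u) (cong (suc (sum dep) ∸_) (sym (child-dep c))))
        (proj₂ (apply-rule (typeAt (sum dep ∸ dep v)) v)))

  module Typed (t : Fin n → Type) (rule : ∀ v → Rule t v (t v)) where

    ¬Z⇒no-L-child : ∀ {v u} → t v ≢ Z → Child v u → t u ≢ L
    ¬Z⇒no-L-child {v} tv≢Z vu with t v | rule v
    ... | .Z  | ruleZ _ _            = contradiction refl tv≢Z
    ... | .L  | ruleL ¬L _           = ¬L vu
    ... | .X₁ | ruleX₁ ¬L _ _ _ _    = ¬L vu
    ... | .X₂ | ruleX₂ ¬L _ _ _ _ _ _ = ¬L vu

    L⇒X₁-child : ∀ {v y} → t v ≡ L → Child v y → t y ≡ Z → ∃ λ w → Child v w × t w ≡ X₁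
    L⇒X₁-child {v} tv≡L with t v | rule v
    L⇒X₁-child refl | .L | ruleL _ X = X

    X₁⇒Z-child : ∀ {v} → t v ≡ X₁ → ∃ λ y → Child v y × t y ≡ Z × (∀ {u} → Child v u → t u ≡ Z → u ≡ y)
    X₁⇒Z-child {v} tv≡X₁ with t v | rule v
    X₁⇒Z-child refl | .X₁ | ruleX₁ _ _ vy y≡Z uniq = _ , vy , y≡Z , uniq

    X₁≢Z : ∀ {v} → t v ≡ X₁ → t v ≢ Z
    X₁≢Z tv≡X₁ tv≡Z = contradiction (trans (sym tv≡X₁) tv≡Z) λ ()

    X₁≢L : ∀ {v} → t v ≡ X₁ → t v ≢ L
    X₁≢L tv≡X₁ tv≡L = contradiction (trans (sym tv≡X₁) tv≡L) λ ()

    ℓ : Fin n → ℕ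
    ℓ v = 𝟙 (t v ≟ᵗ L)

    ℓ≤1 : ∀ v → ℓ v ≤ 1
    ℓ≤1 v = 𝟙≤ (t v ≟ᵗ L) λ _ → ≤-refl

    -- What the subtree of `v` must pay for in both lower bounds; at the root it is the common value
    -- of the three parameters.
    need : Fin n → ℕ
    need = cnt ℓ

    need-¬L : ∀ {v} → t v ≢ L → need v ≡ below ℓ v
    need-¬L {v} tv≢L = trans (cnt-unfold ℓ v) (cong (_+ below ℓ v) (𝟙-no (t v ≟ᵗ L) tv≢L))

    need≤1+below : ∀ v → need v ≤ suc (below ℓ v)
    need≤1+below v = subst (_≤ suc (below ℓ v)) (sym (cnt-unfold ℓ v)) (+-monoˡ-≤ _ (ℓ≤1 v))

    -- Accounting shared by both lower bounds, with `c` marking star edges or guards. Once all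
    -- children cover their needs, a unit at `v` or a surplus below one child can pay for `v`.
    module _ {c : Fin n → ℕ} {v : Fin n} (children : ∀ {u} → Child v u → need u ≤ cnt c u) where

      c+below≤cnt : c v + below ℓ v ≤ cnt c v
      c+below≤cnt = subst (c v + below ℓ v ≤_) (sym (cnt-unfold c v)) (+-monoʳ-≤ (c v) (below-mono-≤ children))

      c+below<cnt : ∀ {w} → Child v w → need w < cnt c w → c v + below ℓ v < cnt c v
      c+below<cnt vw slack = subst (c v + below ℓ v <_) (sym (cnt-unfold c v)) (+-monoʳ-< (c v) (below-mono-< children vw slack))

      below≤cnt : below ℓ v ≤ cnt c v
      below≤cnt = ≤-trans (m≤n+m _ (c v)) c+below≤cnt

      need≤cnt : t v ≢ L → need v ≤ cnt c v
      need≤cnt tv≢L = subst (_≤ cnt c v) (sym (need-¬L tv≢L)) below≤cnt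

      below<cnt : 1 ≤ c v → below ℓ v < cnt c v
      below<cnt 1≤c = ≤-trans (+-monoˡ-≤ (below ℓ v) 1≤c) c+below≤cnt

      slack-child : ∀ {w} → Child v w → need w < cnt c w → below ℓ v < cnt c v
      slack-child vw slack = ≤-trans (s≤s (m≤n+m _ (c v))) (c+below<cnt vw slack)

    -- Lower bound for star partitionings

    module StarBound (P : SimpleStarPartitioning G) where
      open SimpleStarPartitioning P

      -- A star edge is charged to its lower end; `Joined` marks the vertices so charged.
      Joined Big Solo : Fin n → Set
      Joined u = u ≢ r × ∃ λ i → u ∈ part i × par u ∈ part i
      Big u = ∃ λ i → u ∈ part i × ∣ part i ∣ ≢ 1
      Solo u = ∃ λ i → u ∈ part i × ∣ part i ∣ ≡ 1

      joinedIn? : ∀ i u → Dec (u ≢ r × u ∈ part i × par u ∈ part i)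
      joinedIn? i u = ¬? (u ≟ r) ×-dec (u ∈? part i) ×-dec (par u ∈? part i)

      joined? : ∀ u → Dec (Joined u)
      joined? u = ¬? (u ≟ r) ×-dec any? λ i → (u ∈? part i) ×-dec (par u ∈? part i)

      c : Fin n → ℕ
      c u = 𝟙 (joined? u)

      big-or-solo : ∀ v → Big v ⊎ Solo v
      big-or-solo v with covers v
      ... | i , v∈i with ∣ part i ∣ ≟ⁿ 1
      ... | yes eq = inj₂ (i , v∈i , eq)
      ... | no neq = inj₁ (i , v∈i , neq)

      ¬big-solo : ∀ {v} → Big v → ¬ Solo v
      ¬big-solo (i , v∈i , ≢1) (j , v∈j , ≡1) with i ≟ j
      ... | yes refl = ≢1 ≡1
      ... | no  i≢j  = disjoint i≢j (_ , x∈p∩q⁺ (v∈i , v∈j))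

      big-neighbour : ∀ {v i} → v ∈ part i → ∣ part i ∣ ≢ 1 → ∃ λ w → w ∈ part i × Adj v w
      big-neighbour {v} {i} v∈i ≢1 with star i
      ... | x , x∈i , spoke , _ with v ≟ x
      ... | no v≢x = x , x∈i , adj-sym (spoke v∈i v≢x)
      ... | yes refl with any? (λ w → (w ∈? part i) ×-dec ¬? (w ≟ v))
      ... | yes (w , w∈i , w≢v) = w , w∈i , spoke w∈i w≢v
      ... | no ¬∃ = contradiction
        (unique⇒∣p∣≡1 v∈i λ {w} w∈i → decidable-stable (w ≟ v) λ w≢v → ¬∃ (w , w∈i , w≢v)) ≢1

      big⇒joined : ∀ {v} → Big v → Joined v ⊎ ∃ λ u → Child v u × Joined u
      big⇒joined (i , v∈i , ≢1) with big-neighbour v∈i ≢1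
      ... | w , w∈i , vw with edge vw
      ... | inj₁ (w≢r , refl) = inj₂ (w , (w≢r , refl) , w≢r , i , w∈i , v∈i)
      ... | inj₂ (v≢r , refl) = inj₁ (v≢r , i , v∈i , w∈i)

      solo⇒big² : ∀ {v} → Solo v → ∃₂ λ y z → y ≢ z × (Adj v y × Big y) × (Adj v z × Big z)
      solo⇒big² (i , v∈i , ≡1) with single i ≡1
      ... | j , k , j≢k , (u , y , u∈i , y∈j , uy) , ≢1 , (u′ , z , u′∈i , z∈k , u′z) , ≢1′
        with refl ← ∣p∣≡1⇒≡ ≡1 v∈i u∈i | refl ← ∣p∣≡1⇒≡ ≡1 v∈i u′∈i =
        y , z , (λ { refl → disjoint j≢k (_ , x∈p∩q⁺ (y∈j , z∈k)) }) ,
        (uy , j , y∈j , ≢1) , (u′z , k , z∈k , ≢1′)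

      -- At most one of the two big neighbours is the parent.
      solo⇒big-child : ∀ {v} → Solo v → ∃ λ y → Child v y × Big y
      solo⇒big-child s with solo⇒big² s
      ... | y , z , y≢z , (vy , by) , (vz , bz) with edge vy | edge vz
      ... | inj₁ cy | _       = y , cy , by
      ... | inj₂ _  | inj₁ cz = z , cz , bz
      ... | inj₂ (_ , refl) | inj₂ (_ , eq) = contradiction eq y≢z

      Slack : Fin n → Set
      Slack v = need v < cnt c v

      -- The induction hypothesis. The root needs only `bound`; the other fields tell when a subtree
      -- has an edge to spare, with which a vertex of type `L` further up is paid for.
      record Bounds (v : Fin n) : Set where
        field
          bound  : need v ≤ cnt c v
          joined : t v ≢ L → Joined v → Slack v
          big    : t v ≢ L → t v ≢ Z → Big v → Slack v
          solo   : t v ≡ X₁ → v ≢ r → Solo (par v) → Slack v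

      open Bounds

      bounds : ∀ v → Bounds v
      bounds = child-induction Bounds step
        where
        module _ (v : Fin n) (ih : ∀ {u} → Child v u → Bounds u) where
          slack-joined : Joined v → below ℓ v < cnt c v
          slack-joined j = below<cnt (bound ∘ ih) (≤-reflexive (sym (𝟙-yes (joined? v) j)))

          -- A star edge at `v` leads up and is charged to `v`, or leads down to a child; that child
          -- is not of type `L`, so the charge there is a surplus.
          slack-big : t v ≢ Z → Big v → below ℓ v < cnt c v
          slack-big tv≢Z b with big⇒joined b
          ... | inj₁ j            = slack-joined j
          ... | inj₂ (u , vu , j) = slack-child (bound ∘ ih) vu (joined (ih vu) (¬Z⇒no-L-child tv≢Z vu) j)

          ¬L-slack : t v ≢ L → below ℓ v < cnt c v → Slack v
          ¬L-slack tv≢L = subst (_< cnt c v) (sym (need-¬L tv≢L))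

          -- A solo X₁ vertex below a solo parent has two big children, and only
          -- one of them can have type Z.
          slack-solo : t v ≡ X₁ → v ≢ r → Solo (par v) → below ℓ v < cnt c v
          slack-solo tv≡X₁ v≢r sp with big-or-solo v
          ... | inj₁ b = slack-big (X₁≢Z tv≡X₁) b
          ... | inj₂ s with solo⇒big² s | X₁⇒Z-child tv≡X₁
          ... | y , z , y≢z , (vy , by) , (vz , bz) | x , _ , _ , uniq with edge vy | edge vz
          ... | inj₂ (_ , refl) | _ = contradiction sp (¬big-solo by)
          ... | inj₁ _ | inj₂ (_ , refl) = contradiction sp (¬big-solo bz)
          ... | inj₁ cy | inj₁ cz with t y ≟ᵗ Z | t z ≟ᵗ Z
          ... | no ty≢Z | _ = slack-child (bound ∘ ih) cy (big (ih cy) (¬Z⇒no-L-child (X₁≢Z tv≡X₁) cy) ty≢Z by)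
          ... | yes _ | no tz≢Z = slack-child (bound ∘ ih) cz (big (ih cz) (¬Z⇒no-L-child (X₁≢Z tv≡X₁) cz) tz≢Z bz)
          ... | yes ty≡Z | yes tz≡Z = contradiction (trans (uniq cy ty≡Z) (sym (uniq cz tz≡Z))) y≢z

          -- A solo `v` has a big child. This child has a surplus unless it has type `Z`; but then
          -- `v` also has an `X₁` child, which has a surplus because its parent is solo.
          slack-L : t v ≡ L → below ℓ v < cnt c v
          slack-L tv≡L with big-or-solo v
          ... | inj₁ b = slack-big (λ tv≡Z → contradiction (trans (sym tv≡L) tv≡Z) λ ()) b
          ... | inj₂ s with solo⇒big-child s
          ... | y , vy , by with t y ≟ᵗ Z
          ... | no ty≢Z = slack-child (bound ∘ ih) vy
            (big (ih vy) (¬Z⇒no-L-child (λ tv≡Z → contradiction (trans (sym tv≡L) tv≡Z) λ ()) vy) ty≢Z by)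
          ... | yes ty≡Z with L⇒X₁-child tv≡L vy ty≡Z
          ... | w , vw@(w≢r , refl) , tw≡X₁ = slack-child (bound ∘ ih) vw (solo (ih vw) tw≡X₁ w≢r s)

          bound-step : need v ≤ cnt c v
          bound-step with t v ≟ᵗ L
          ... | no tv≢L  = need≤cnt (bound ∘ ih) tv≢L
          ... | yes tv≡L = ≤-trans (need≤1+below v) (slack-L tv≡L)

          step : Bounds v
          step = record
            { bound  = bound-step
            ; joined = λ tv≢L j → ¬L-slack tv≢L (slack-joined j)
            ; big    = λ tv≢L tv≢Z b → ¬L-slack tv≢L (slack-big tv≢Z b)
            ; solo   = λ tv≡X₁ v≢r s → ¬L-slack (X₁≢L tv≡X₁) (slack-solo tv≡X₁ v≢r s)
            }

      -- The topmost vertex of a star is not joined to its parent within the star.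
      joinedIn-bound : ∀ i → sum (λ u → 𝟙 (joinedIn? i u)) ≤ ∣ part i ∣ ∸ 1
      joinedIn-bound i = ≤-pred (subst (suc (sum λ u → 𝟙 (joinedIn? i u)) ≤_) (sym 1+pred) lt)
        where
        top : ∃ λ x → x ∈ part i × ¬ (x ≢ r × x ∈ part i × par x ∈ part i)
        top with star i
        ... | x , x∈i , _ , ¬rim with joinedIn? i x
        ... | no ¬j = x , x∈i , ¬j
        -- If the centre `x` shares the part with its parent, that parent is topmost: its own parent
        -- would be a second rim vertex adjacent to it.
        ... | yes (x≢r , _ , px∈i) = par x , px∈i , λ (px≢r , _ , ppx∈i) →
          ¬rim px∈i ppx∈i
            (λ eq → irrefl x (subst (Adj x) eq (par-adj x≢r)))
            (λ eq → m≢1+n+m (dep x) {1} (trans (dep-par x≢r) (trans (cong suc (dep-par px≢r)) (cong (λ u → suc (suc (dep u))) eq))))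
            (par-adj px≢r)
        lt : suc (sum λ u → 𝟙 (joinedIn? i u)) ≤ ∣ part i ∣
        lt = subst (suc (sum λ u → 𝟙 (joinedIn? i u)) ≤_) (sym (∣p∣≡sum (part i)))
          (sum-mono-< (λ u → 𝟙-mono (joinedIn? i u) (u ∈? part i) (proj₁ ∘ proj₂)) (proj₁ top)
            (subst₂ _<_ (sym (𝟙-no (joinedIn? i _) (proj₂ (proj₂ top)))) (sym (𝟙-yes (_ ∈? part i) (proj₁ (proj₂ top)))) ≤-refl))
        1+pred : suc (∣ part i ∣ ∸ 1) ≡ ∣ part i ∣
        1+pred with ∣ part i ∣ | lt
        ... | suc _ | _ = refl

      weight-bound : need r ≤ weight
      weight-bound = begin
        need r                                       ≤⟨ bound (bounds r) ⟩
        cnt c r                                      ≡⟨ cnt-root c ⟩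
        sum c                                        ≤⟨ sum-mono-≤ c≤ ⟩
        sum (λ u → sum λ i → 𝟙 (joinedIn? i u))      ≡⟨ ∑-comm (λ u i → 𝟙 (joinedIn? i u)) ⟩
        sum (λ i → sum λ u → 𝟙 (joinedIn? i u))      ≤⟨ sum-mono-≤ joinedIn-bound ⟩
        weight                                       ∎
        where
        open ≤-Reasoning
        c≤ : ∀ u → c u ≤ sum λ i → 𝟙 (joinedIn? i u)
        c≤ u = 𝟙≤ (joined? u) λ (u≢r , i , u∈i , pu∈i) → ≤-trans
          (≤-reflexive (sym (𝟙-yes (joinedIn? i u) (u≢r , u∈i , pu∈i)))) (term≤sum (λ i → 𝟙 (joinedIn? i u)) i)

    -- Lower bound for eviction families

    guards-in : Subset n → Fin n → ℕ
    guards-in D = cnt λ u → 𝟙 (u ∈? D)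

    guards-in-root : ∀ D → guards-in D r ≡ ∣ D ∣
    guards-in-root D = trans (cnt-root _) (sym (∣p∣≡sum D))

    -- A guard enters the subtree of v only along the edge from par v to v.
    no-entry : ∀ {D D′ v} → GuardMove G D D′ → (v ≢ r → v ∈ D′ → par v ∉ D) → guards-in D′ v ≤ guards-in D v
    no-entry {D} {D′} {v} (f , move) barred =
      subst₂ _≤_ (sym (count D′)) (sym (count D))
        (count-injection (inside? D′) (inside? D) origin origin-inside origin-injective)
      where
      inside? : ∀ D u → Dec (u ⊑ v × u ∈ D)
      inside? D u = (u ⊑? v) ×-dec (u ∈? D)
      count : ∀ D → guards-in D v ≡ sum λ u → 𝟙 (inside? D u)
      count D = sum-cong-≗ λ u → 𝟙-× (u ⊑? v) (u ∈? D)
      f⁻¹ : ∀ y → ∃ λ x → Bijection.to f x ≡ y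
      f⁻¹ y = let x , eq = Bijection.surjective f y in x , eq refl
      origin : ∀ u → u ⊑ v × u ∈ D′ → Fin n
      origin u (_ , u∈D′) = proj₁ (proj₁ (f⁻¹ (u , u∈D′)))
      from-inside : ∀ x → proj₁ (Bijection.to f x) ⊑ v → proj₁ x ⊑ v × proj₁ x ∈ D
      from-inside x y⊑v with Bijection.to f x | move x
      ... | _ , _    | inj₁ refl = y⊑v , proj₂ x
      ... | _ , y∈D′ | inj₂ xy with proj₁ x ⊑? v
      ... | yes x⊑v = x⊑v , proj₂ x
      ... | no  x⋢v with refl , v≢r , x≡pv ← ⊑-entry xy y⊑v x⋢v =
        contradiction (subst (_∈ D) x≡pv (proj₂ x)) (barred v≢r y∈D′)
      origin-inside : ∀ u p → origin u p ⊑ v × origin u p ∈ D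
      origin-inside u (u⊑v , u∈D′) =
        let x , eq = f⁻¹ (u , u∈D′) in from-inside x (subst (_⊑ v) (sym (cong proj₁ eq)) u⊑v)
      origin-injective : ∀ i j p q → origin i p ≡ origin j q → i ≡ j
      origin-injective i j (_ , p) (_ , q) eq =
        cong proj₁ (trans (sym (proj₂ (f⁻¹ (i , p)))) (trans (cong (Bijection.to f) (⟦⟧-≡ eq)) (proj₂ (f⁻¹ (j , q)))))

    module EvictionBound {k : ℕ} (F : EvictionFamily G k) where
      open EvictionFamily F

      -- All fields quantify over the members of the family, so they apply before and after a
      -- response. In `pinned` the vertex `y` is chosen before `D`, so that the same `y` is forced
      -- both times.
      record Bounds (v : Fin n) : Set where
        field
          bound    : t v ≢ L → ∀ {D} → Member D → need v ≤ guards-in D v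
          bound-L  : t v ≡ L → v ≢ r → ∀ {D} → Member D → par v ∉ D → need v ≤ guards-in D v
          occupied : t v ≢ L → t v ≢ Z → ∀ {D} → Member D → v ∈ D → need v < guards-in D v
          pinned   : t v ≡ X₁ → ∃ λ y → ∀ {D} → Member D → par v ∉ D → need v < guards-in D v ⊎ y ∈ D

      open Bounds

      bounds : ∀ v → Bounds v
      bounds = child-induction Bounds step
        where
        module _ (v : Fin n) (ih : ∀ {u} → Child v u → Bounds u) where

          ¬Z-children : t v ≢ Z → ∀ {D} → Member D → ∀ {u} → Child v u → need u ≤ guards-in D u
          ¬Z-children tv≢Z D∈F vu = bound (ih vu) (¬Z⇒no-L-child tv≢Z vu) D∈F

          unoccupied-children : ∀ {D} → Member D → v ∉ D → ∀ {u} → Child v u → need u ≤ guards-in D u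
          unoccupied-children D∈F v∉D {u} vu with t u ≟ᵗ L
          ... | no tu≢L = bound (ih vu) tu≢L D∈F
          unoccupied-children D∈F v∉D {u} vu@(u≢r , refl) | yes tu≡L = bound-L (ih vu) tu≡L u≢r D∈F v∉D

          -- If `v` is occupied, it is attacked. Afterwards `v` is empty, so every child covers its
          -- need; and no guard has entered the subtree, so it held at least as many guards before.
          bound-step : t v ≢ L → ∀ {D} → Member D → need v ≤ guards-in D v
          bound-step tv≢L {D} D∈F with v ∈? D
          ... | no v∉D  = need≤cnt (unoccupied-children D∈F v∉D) tv≢L
          ... | yes v∈D with respond D∈F v∈D
          ... | D′ , D′∈F , v∉D′ , move =
            ≤-trans (need≤cnt (unoccupied-children D′∈F v∉D′) tv≢L) (no-entry move λ _ v∈D′ → contradiction v∈D′ v∉D′)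

          occupied-step : t v ≢ Z → ∀ {D} → Member D → v ∈ D → below ℓ v < guards-in D v
          occupied-step tv≢Z {D} D∈F v∈D =
            below<cnt (¬Z-children tv≢Z D∈F) (≤-reflexive (sym (𝟙-yes (v ∈? D) v∈D)))

          slack-child-step : t v ≢ Z → ∀ {D} → Member D → ∀ {w} → Child v w → t w ≢ Z → w ∈ D → below ℓ v < guards-in D v
          slack-child-step tv≢Z D∈F vw tw≢Z w∈D =
            slack-child (¬Z-children tv≢Z D∈F) vw (occupied (ih vw) (¬Z⇒no-L-child tv≢Z vw) tw≢Z D∈F w∈D)

          -- With no guard on a parent, `v` is dominated by a guard on itself or on a child, and
          -- that guard is a surplus unless the child has type `Z`.
          dominated : t v ≢ Z → ∀ {D} → Member D → (v ≢ r → par v ∉ D) →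
            below ℓ v < guards-in D v ⊎ ∃ λ y → Child v y × t y ≡ Z × y ∈ D
          dominated tv≢Z D∈F pv∉D with dominating D∈F v
          ... | inj₁ v∈D = inj₁ (occupied-step tv≢Z D∈F v∈D)
          ... | inj₂ (w , w∈D , wv) with edge wv
          ... | inj₁ (v≢r , refl) = contradiction w∈D (pv∉D v≢r)
          ... | inj₂ vw with t w ≟ᵗ Z
          ... | yes tw≡Z = inj₂ (w , vw , tw≡Z , w∈D)
          ... | no  tw≢Z = inj₁ (slack-child-step tv≢Z D∈F vw tw≢Z w∈D)

          pinned-step : t v ≡ X₁ → ∃ λ y → ∀ {D} → Member D → par v ∉ D → need v < guards-in D v ⊎ y ∈ D
          pinned-step tv≡X₁ with X₁⇒Z-child tv≡X₁
          ... | y , vy , ty≡Z , uniq = y , pin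
            where
            pin : ∀ {D} → Member D → par v ∉ D → need v < guards-in D v ⊎ y ∈ D
            pin {D} D∈F pv∉D with dominated (X₁≢Z tv≡X₁) D∈F (λ _ → pv∉D)
            ... | inj₁ slack = inj₁ (subst (_< guards-in D v) (sym (need-¬L (X₁≢L tv≡X₁))) slack)
            ... | inj₂ (z , vz , tz≡Z , z∈D) = inj₂ (subst (_∈ D) (uniq vz tz≡Z) z∈D)

          -- With too few guards below v, its X₁ child w depends on a guard at the only Z child
          -- of w; evicting that guard brings no guard into the subtree of v, so w is undominated.
          L-step : t v ≡ L → v ≢ r → ∀ {D} → Member D → par v ∉ D → below ℓ v < guards-in D v
          L-step tv≡L v≢r {D} D∈F pv∉D with dominated tv≢Z D∈F (λ _ → pv∉D)
            where
            tv≢Z : t v ≢ Z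
            tv≢Z tv≡Z = contradiction (trans (sym tv≡L) tv≡Z) λ ()
          ... | inj₁ slack = slack
          ... | inj₂ (z , vz , tz≡Z , z∈D) with L⇒X₁-child tv≡L vz tz≡Z
          ... | w , vw@(w≢r , refl) , tw≡X₁ with pinned (ih vw) tw≡X₁
          ... | y , pin = conclude
            where
            tv≢Z : t v ≢ Z
            tv≢Z tv≡Z = contradiction (trans (sym tv≡L) tv≡Z) λ ()
            slack-or-pinned : ∀ {D} → Member D → below ℓ v < guards-in D v ⊎ y ∈ D
            slack-or-pinned {D} D∈F with v ∈? D
            ... | yes v∈D = inj₁ (occupied-step tv≢Z D∈F v∈D)
            ... | no v∉D with pin D∈F v∉D
            ... | inj₁ slack = inj₁ (slack-child (¬Z-children tv≢Z D∈F) vw slack)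
            ... | inj₂ y∈D   = inj₂ y∈D
            conclude : below ℓ v < guards-in D v
            conclude with slack-or-pinned D∈F
            ... | inj₁ slack = slack
            ... | inj₂ y∈D with respond D∈F y∈D
            ... | D′ , D′∈F , y∉D′ , move with slack-or-pinned D′∈F
            ... | inj₁ slack = ≤-trans slack (no-entry move λ _ _ → pv∉D)
            ... | inj₂ y∈D′  = contradiction y∈D′ y∉D′

          step : Bounds v
          step = record
            { bound    = bound-step
            ; bound-L  = λ tv≡L v≢r D∈F pv∉D → ≤-trans (need≤1+below v) (L-step tv≡L v≢r D∈F pv∉D)
            ; occupied = λ tv≢L tv≢Z {D} D∈F v∈D →
                subst (_< guards-in D v) (sym (need-¬L tv≢L)) (occupied-step tv≢Z D∈F v∈D)
            ; pinned   = pinned-step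
            }

      eviction-bound : t r ≢ L → need r ≤ k
      eviction-bound tr≢L with inhabited
      ... | D , D∈F = subst (need r ≤_) (trans (guards-in-root D) (guards D∈F)) (bound (bounds r) tr≢L D∈F)

    -- Matching the vertices of type L

    L-child⇒Z : ∀ {v u} → Child v u → t u ≡ L → t v ≡ Z
    L-child⇒Z {v} vu tu≡L = decidable-stable (t v ≟ᵗ Z) λ tv≢Z → ¬Z⇒no-L-child tv≢Z vu tu≡L

    X₁-child⇒L⊎Z : ∀ {v u} → Child v u → t u ≡ X₁ → t v ≡ L ⊎ t v ≡ Z
    X₁-child⇒L⊎Z {v} vu tu≡X₁ with t v | rule v
    ... | .Z  | ruleZ _ _             = inj₂ refl
    ... | .L  | ruleL _ _             = inj₁ refl
    ... | .X₁ | ruleX₁ _ ¬X _ _ _     = contradiction tu≡X₁ (¬X vu)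
    ... | .X₂ | ruleX₂ _ ¬X _ _ _ _ _ = contradiction tu≡X₁ (¬X vu)

    childless⇒L : ∀ {v} → (∀ {u} → ¬ Child v u) → t v ≡ L
    childless⇒L {v} ¬child with t v | rule v
    ... | .Z  | ruleZ vu _            = contradiction vu ¬child
    ... | .L  | ruleL _ _             = refl
    ... | .X₁ | ruleX₁ _ _ vy _ _     = contradiction vy ¬child
    ... | .X₂ | ruleX₂ _ _ vy _ _ _ _ = contradiction vy ¬child

    childless⇒leaf : ∀ {v u} → Child v u → (∀ {w} → ¬ Child u w) → IsLeaf G u
    childless⇒leaf {v} {u} vu@(_ , pu≡v) ¬child = unique-leaf G (child-adj vu) only
      where
      only : ∀ {w} → Adj u w → w ≡ v
      only uw with edge uw
      ... | inj₁ child      = contradiction child ¬child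
      ... | inj₂ (_ , pu≡w) = trans (sym pu≡w) pu≡v

    module Pairing (weak : IsWeak G) (root-Z : t r ≡ Z) where

      -- The last condition lets every other `L` child find its partner among its own children.
      IsPreferred : Fin n → Fin n → Set
      IsPreferred v u = Child v u × t u ≡ L × (∀ {w} → Child v w → w ≢ u → ∃ (Child w))

      preferred : ∀ v → ∃ λ u → t v ≡ Z → IsPreferred v u
      preferred v with any? (λ u → child? v u ×-dec ¬? (any? (child? u)))
      ... | yes (u , vu , ¬∃) = u , λ _ → vu , childless⇒L (λ uw → ¬∃ (_ , uw)) , other
        where
        other : ∀ {w} → Child v w → w ≢ u → ∃ (Child w)
        other {w} vw w≢u = decidable-stable (any? (child? w)) λ ¬∃w → weak
          (v , u , w , w≢u ∘ sym , adj-sym (child-adj vu) , adj-sym (child-adj vw) ,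
           childless⇒leaf vu (λ c → ¬∃ (_ , c)) , childless⇒leaf vw (λ c → ¬∃w (_ , c)))
      ... | no ¬∃ with t v | rule v
      ... | .Z | ruleZ {u} vu tu≡L = u , λ _ → vu , tu≡L ,
        λ {w} vw _ → decidable-stable (any? (child? w)) λ ¬∃w → ¬∃ (w , vw , ¬∃w)
      ... | .L  | ruleL _ _             = v , λ ()
      ... | .X₁ | ruleX₁ _ _ _ _ _      = v , λ ()
      ... | .X₂ | ruleX₂ _ _ _ _ _ _ _  = v , λ ()

      -- No child of an `L` vertex has type `L`; if the child at hand has type `Z`, the rule for `L`
      -- supplies an `X₁` child instead.
      lender : ∀ v → ∃ λ x → t v ≡ L → ∃ (Child v) → Child v x × t x ≢ L × t x ≢ Z
      lender v with any? (λ x → child? v x ×-dec ¬? (t x ≟ᵗ L) ×-dec ¬? (t x ≟ᵗ Z))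
      ... | yes (x , spec) = x , λ _ _ → spec
      ... | no ¬∃ = v , λ tv≡L (u , vu) → contradiction (search tv≡L vu) ¬∃
        where
        search : ∀ {u} → t v ≡ L → Child v u → ∃ λ x → Child v x × t x ≢ L × t x ≢ Z
        search {u} tv≡L vu with t u ≟ᵗ Z
        ... | no tu≢Z = u , vu , ¬Z⇒no-L-child (λ tv≡Z → contradiction (trans (sym tv≡L) tv≡Z) λ ()) vu , tu≢Z
        ... | yes tu≡Z = let w , vw , tw≡X₁ = L⇒X₁-child tv≡L vu tu≡Z in w , vw , X₁≢L tw≡X₁ , X₁≢Z tw≡X₁

      -- The anchor is the one child coloured like its parent; y ≡ v encodes that there is none.
      IsAnchor : Fin n → Fin n → Type → Set
      IsAnchor v y L  = y ≡ v
      IsAnchor v y X₁ = Child v y × t y ≡ Z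
      IsAnchor v y X₂ = Child v y × t y ≡ Z × ∃ λ z → Child v z × t z ≡ Z × z ≢ y
      IsAnchor v y Z  = y ≡ v

      anchor : ∀ v → ∃ λ y → IsAnchor v y (t v)
      anchor v with t v | rule v
      ... | .Z  | ruleZ _ _                      = v , refl
      ... | .L  | ruleL _ _                      = v , refl
      ... | .X₁ | ruleX₁ _ _ vy ty≡Z _           = _ , vy , ty≡Z
      ... | .X₂ | ruleX₂ _ _ vy ty≡Z vz tz≡Z z≢y = _ , vy , ty≡Z , _ , vz , tz≡Z , z≢y

      π σ δ : Fin n → Fin n
      π = proj₁ ∘ preferred
      σ = proj₁ ∘ lender
      δ = proj₁ ∘ anchor

      anchored : ∀ {v k} → t v ≡ k → IsAnchor v (δ v) k
      anchored {v} refl = proj₂ (anchor v)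

      -- The partner has type `Z` for `up` and not for `down`; this keeps edges of the two kinds
      -- from sharing a partner.
      data Pair (u : Fin n) : Fin n → Set where
        up   : ∀ {p} → Child p u → u ≡ π p → t p ≡ Z → Pair u p
        down : ∀ {x} → Child u x → t x ≢ L → t x ≢ Z → Pair u x

      q : Fin n → Fin n
      q u = if does (u ≟ π (par u)) then par u else σ u

      L⇒≢r : ∀ {u} → t u ≡ L → u ≢ r
      L⇒≢r tu≡L refl = contradiction (trans (sym tu≡L) root-Z) λ ()

      pair : ∀ {u} → t u ≡ L → Pair u (q u)
      pair {u} tu≡L with L-child⇒Z (L⇒≢r tu≡L , refl) tu≡L | u ≟ π (par u)
      ... | tp≡Z | yes u≡π = up (L⇒≢r tu≡L , refl) u≡π tp≡Z
      ... | tp≡Z | no  u≢π =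
        let _ , _ , others = proj₂ (preferred (par u)) tp≡Z
            ux , tx≢L , tx≢Z = proj₂ (lender u) tu≡L (others (L⇒≢r tu≡L , refl) u≢π)
        in down ux tx≢L tx≢Z

      pair-adj : ∀ {u x} → Pair u x → Adj u x
      pair-adj (up pu _ _)   = child-adj pu
      pair-adj (down ux _ _) = adj-sym (child-adj ux)

      pair-¬L : ∀ {u x} → Pair u x → t x ≢ L
      pair-¬L (up _ _ tp≡Z)    tp≡L = contradiction (trans (sym tp≡L) tp≡Z) λ ()
      pair-¬L (down _ tx≢L _) = tx≢L

      pair-injective : ∀ {u v x} → Pair u x → Pair v x → u ≡ v
      pair-injective (up _ u≡π _)         (up _ v≡π _)        = trans u≡π (sym v≡π)
      pair-injective (up _ _ tx≡Z)        (down _ _ tx≢Z)     = contradiction tx≡Z tx≢Z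
      pair-injective (down _ _ tx≢Z)      (up _ _ tx≡Z)       = contradiction tx≡Z tx≢Z
      pair-injective (down (_ , pu) _ _)  (down (_ , pv) _ _) = trans (sym pu) pv

      π-L : ∀ {v} → t v ≡ Z → t (π v) ≡ L
      π-L {v} tv≡Z = proj₁ (proj₂ (proj₂ (preferred v) tv≡Z))

      q-π : ∀ {v} → t v ≡ Z → q (π v) ≡ v
      q-π {v} tv≡Z with proj₂ (preferred v) tv≡Z
      ... | (_ , eq) , _ = trans
        (cong (λ b → if b then par (π v) else σ (π v)) (dec-true (π v ≟ π (par (π v))) (cong π (sym eq)))) eq

      -- The depth is passed separately to make the recursion structural. Keeping the parent's
      -- colour at the anchor gives an unmatched vertex a neighbour of its own colour.
      colAt : ℕ → Fin n → Bool
      colAt zero    v = true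
      colAt (suc d) v = if does (v ≟ δ (par v)) then colAt d (par v) else not (colAt d (par v))

      col : Fin n → Bool
      col v = colAt (dep v) v

      col-anchor : ∀ {v} → Child v (δ v) → col (δ v) ≡ col v
      col-anchor {v} vy@(_ , eq) rewrite child-dep vy | eq | dec-true (δ v ≟ δ v) refl = refl

      col-flip : ∀ {v y} → Child v y → y ≢ δ v → col y ≡ not (col v)
      col-flip {v} {y} vy@(_ , refl) y≢δ rewrite child-dep vy | dec-false (y ≟ δ v) y≢δ = refl

      -- For these types `δ v` is `v`, which is not its own child. The upper end of a matching edge
      -- has type `L` or `Z`, so the two ends always differ in colour.
      ≢anchor : ∀ {v y} → t v ≡ L ⊎ t v ≡ Z → Child v y → y ≢ δ v
      ≢anchor {v} (inj₁ tv≡L) vy refl = irrefl v (subst (λ y → Adj y v) (anchored tv≡L) (child-adj vy))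
      ≢anchor {v} (inj₂ tv≡Z) vy refl = irrefl v (subst (λ y → Adj y v) (anchored tv≡Z) (child-adj vy))

      pair-col : ∀ {u x} → t u ≡ L → Pair u x → col x ≡ not (col u)
      pair-col tu≡L (up pu _ tp≡Z) =
        trans (sym (not-involutive _)) (cong not (sym (col-flip pu (≢anchor (inj₂ tp≡Z) pu))))
      pair-col tu≡L (down ux _ _)  = col-flip ux (≢anchor (inj₁ tu≡L) ux)

      Paired : Fin n → Set
      Paired v = t v ≡ L ⊎ ∃ λ u → t u ≡ L × q u ≡ v

      Z-paired : ∀ {v} → t v ≡ Z → Paired v
      Z-paired tv≡Z = inj₂ (_ , π-L tv≡Z , q-π tv≡Z)

      -- The anchor supplies the equal colour. The other colour comes from a second `Z` child for
      -- `X₂`, and for `X₁` from the parent, which has type `L` or `Z` and therefore is paired and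
      -- has no anchor.
      unpaired : ∀ v → ¬ Paired v →
        ∃₂ λ y z → (Paired y × Adj y v × col y ≡ col v) × (Paired z × Adj z v × col z ≡ not (col v))
      unpaired v ¬p = go (t v) refl
        where
        go : ∀ k → t v ≡ k → ∃₂ λ y z → (Paired y × Adj y v × col y ≡ col v) × (Paired z × Adj z v × col z ≡ not (col v))
        go L  tv = contradiction (inj₁ tv) ¬p
        go Z  tv = contradiction (Z-paired tv) ¬p
        go X₂ tv with anchored tv
        ... | vy , ty≡Z , z , vz , tz≡Z , z≢y = δ v , z ,
          (Z-paired ty≡Z , child-adj vy , col-anchor vy) , (Z-paired tz≡Z , child-adj vz , col-flip vz z≢y)
        go X₁ tv with anchored tv | X₁-child⇒L⊎Z (v≢r , refl) tv
          where
          v≢r : v ≢ r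
          v≢r refl = X₁≢Z tv root-Z
        ... | vy , ty≡Z | tp = δ v , par v ,
          (Z-paired ty≡Z , child-adj vy , col-anchor vy) ,
          ([ inj₁ , Z-paired ]′ tp , adj-sym (par-adj v≢r) ,
           trans (sym (not-involutive _)) (cong not (sym (col-flip (v≢r , refl) (≢anchor tp (v≢r , refl))))))
          where
          v≢r : v ≢ r
          v≢r refl = X₁≢Z tv root-Z

      coloured-matching : ColouredMatching G
      coloured-matching = record
        { M                 = λ v → t v ≡ L
        ; M?                = λ v → t v ≟ᵗ L
        ; partner           = q
        ; partner-adj       = pair-adj ∘ pair
        ; partner-∉         = pair-¬L ∘ pair
        ; partner-injective = λ {_} {v} tu≡L tv≡L eq → pair-injective (pair tu≡L) (subst (Pair v) (sym eq) (pair tv≡L))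
        ; col               = col
        ; col-partner       = λ tu≡L → pair-col tu≡L (pair tu≡L)
        ; unmatched         = unpaired
        }

  -- The parity of the depth is a proper 2-colouring.
  triangle-free : ∀ {x y z} → Adj x y → Adj y z → ¬ Adj x z
  triangle-free {x} {y} {z} xy yz xz = not-¬ refl (trans (sym (parity xz)) (trans (parity xy) (cong not (parity yz))))
    where
    even : ℕ → Bool
    even zero    = true
    even (suc k) = not (even k)
    parity : ∀ {u v} → Adj u v → even (dep u) ≡ not (even (dep v))
    parity uv with edge uv
    ... | inj₁ vu = trans (sym (not-involutive _)) (cong not (sym (cong even (child-dep vu))))
    ... | inj₂ uv = cong even (child-dep uv)

-- Eviction families from swap sets, and the equality of the three numbers

swap⇒eviction : (G : Graph n) {D : Subset n} → IsSwapSet G D → EvictionFamily G ∣ D ∣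
swap⇒eviction {n} G {D} (dom , D′ , dom′ , disjoint , ∣D∣≡∣D′∣ , f , adj) = record
  { Member     = λ X → X ≡ D ⊎ X ≡ D′
  ; inhabited  = D , inj₁ refl
  ; dominating = λ { (inj₁ refl) → dom ; (inj₂ refl) → dom′ }
  ; guards     = λ { (inj₁ refl) → refl ; (inj₂ refl) → sym ∣D∣≡∣D′∣ }
  ; respond    = λ where
      (inj₁ refl) v∈D  → D′ , inj₂ refl , (λ v∈D′ → disjoint (_ , x∈p∩q⁺ (v∈D , v∈D′))) , f , inj₂ ∘ adj
      (inj₂ refl) v∈D′ → D  , inj₁ refl , (λ v∈D → disjoint (_ , x∈p∩q⁺ (v∈D , v∈D′))) , sym-≡ f , back
  }
  where
  open Graph G renaming (sym to adj-sym)
  back : ∀ y → let x = proj₁ (Bijection.to (sym-≡ f) y) in x ≡ proj₁ y ⊎ Adj (proj₁ y) x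
  back y with Bijection.surjective f y
  ... | x , eq = inj₂ (adj-sym (subst (Adj (proj₁ x)) (cong proj₁ (eq refl)) (adj x)))

-- A provisional rooting at `zero` yields a childless vertex other than the root, hence a leaf; its
-- neighbour becomes the final root.
support-vertex : (G : Graph n) → 2 ≤ n → IsTree G → ∃₂ λ s u → Graph.Adj G u s × (∀ {w} → Graph.Adj G u w → w ≡ s)
support-vertex G (s≤s (s≤s _)) tree with Rooted.childless-vertex G (root G tree zero) (suc zero) (λ ())
... | u , u≢r , ¬child = par u , u , par-adj u≢r , only
  where
  open Graph G using (Adj)
  open Rooting (root G tree zero)
  only : ∀ {w} → Adj u w → w ≡ par u
  only uw with edge uw
  ... | inj₁ child    = contradiction child ¬child
  ... | inj₂ (_ , eq) = sym eq

corollary12 : ∀ (n : ℕ) → 2 ≤ n → (T : Graph n) → IsTree T → IsWeak T →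
    ∃ λ k → IsSwapNumber T [ k ] × IsStarNumber T k × IsEvictionNumber T k
corollary12 n 2≤n T tree weak with support-vertex T 2≤n tree
... | r , u , ur , only =
  k ,
  ((class 𝓜 true , swap-set 𝓜 , ∣class∣ 𝓜 true) ,
   -- The guards can alternate between any swap set and its partner, so the eviction bound also
   -- bounds the swap number.
   λ { _ (D , swap , refl) → evict-bound (swap⇒eviction T swap) }) ,
  (let P , weight≤k = star-partitioning 𝓜 triangle-free in
   (P , ≤-antisym weight≤k (star-bound P)) , λ { _ (Q , refl) → star-bound Q }) ,
  subst (EvictionFamily T) (∣class∣ 𝓜 true) (swap⇒eviction T (swap-set 𝓜)) ,
  λ _ → evict-bound
  where
  open Graph T renaming (sym to adj-sym)
  open Rooting (root T tree r)
  open Rooted T (root T tree r)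
  open Typed (proj₁ typing) (proj₂ typing)

  u≢r : u ≢ r
  u≢r refl = irrefl r ur

  root-Z : proj₁ typing r ≡ Z
  -- The leaf `u` is a childless child of `r`; it has type `L` and thereby forces type `Z` on `r`.
  root-Z = L-child⇒Z (u≢r , only (par-adj u≢r)) (childless⇒L λ uw → proj₁ uw (only (adj-sym (child-adj uw))))

  𝓜 : ColouredMatching T
  𝓜 = Pairing.coloured-matching weak root-Z

  k : ℕ
  k = size-of-matching 𝓜

  star-bound : ∀ P → k ≤ SimpleStarPartitioning.weight P
  -- The matching has one edge per vertex of type `L`, so `k` unfolds to `sum ℓ`, which `cnt-root`
  -- identifies with `need r`.
  star-bound P = subst (_≤ _) (cnt-root ℓ) (StarBound.weight-bound P)

  evict-bound : ∀ {j} → EvictionFamily T j → k ≤ j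
  evict-bound F = subst (_≤ _) (cnt-root ℓ)
    (EvictionBound.eviction-bound F λ tr≡L → contradiction (trans (sym root-Z) tr≡L) λ ())
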